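{- Let $\alpha,\beta$ be parameters, $q$ an indeterminate, $E_{n,k}(\alpha,\beta,q)$ the numbers defined in the context, and $E_n(x;q)=\sum_{k=0}^nE_{n,k}(\alpha,\beta,q)x^k$. Then: (i) for $n\ge1$, $E_{n}(x;q)=\bigl([\beta]+q^\beta[n-1+\alpha]x\bigr)E_{n-1}(x;q)+(1-x)xq^{\beta}\delta_{x}(E_{n-1}(x;q))$; (ii) for $n\ge0$, $\dfrac{E_{n}(x;q)}{(x;q)_{n+\alpha+\beta}}=\sum_{j\ge 0}x^j\begin{bmatrix}j+\alpha+\beta-1\\ j\end{bmatrix}[j+\beta]^n$; (iii) $\displaystyle\sum_{n\ge 0}\frac{E_{n}(x;q)}{(x;q)_{n+\alpha+\beta}}\frac{t^n}{n!}=\sum_{j\ge 0}x^j\begin{bmatrix}j+\alpha+\beta-1\\ j\end{bmatrix}\exp([j+\beta]t)$; (iv) for $n,j\ge0$, $\displaystyle\sum_{k=0}^{j}\begin{bmatrix}j-k+n+\alpha+\beta-1\\ j-k\end{bmatrix}E_{n,k}(\alpha,\beta,q)=\begin{bmatrix}j+\alpha+\beta-1\\ j\end{bmatrix}[j+\beta]^n$; (v) for $n\ge k\ge0$, $\displaystyle E_{n,k}(\alpha,\beta,q)=\sum_{j=0}^{k}\begin{bmatrix}n+\alpha+\beta\\ k-j\end{bmatrix}\begin{bmatrix}j+\alpha+\beta-1\\ j\end{bmatrix}(-1)^{k-j}q^{\binom{k-j}{2}}[\beta+j]^{n}$.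
   Context: For a real $x$, $[x]=\frac{1-q^x}{1-q}$. The numbers $E_{n,k}(\alpha,\beta,q)$ are determined by $E_{0,0}=1$, $E_{n,k}=0$ if $k\notin\{0,\dots,n\}$, and for $n\ge1$: $E_{n,k}(\alpha,\beta,q)=q^{\beta+k-1}[n-k+\alpha]E_{n-1,k-1}(\alpha,\beta,q)+[k+\beta]E_{n-1,k}(\alpha,\beta,q)$. The $q$-derivative is $\delta_x p(x)=\frac{p(qx)-p(x)}{(q-1)x}$. $q$-Pochhammer: $(x;q)_\infty=\prod_{i\ge0}(1-xq^i)$ and for real $N$, $(x;q)_N=(x;q)_\infty/(xq^N;q)_\infty$ (so $(x;q)_0=1$, $(x;q)_n=\prod_{i=0}^{n-1}(1-xq^i)$ for integers $n\ge1$). For real $x$ and integer $n\ge0$, $\begin{bmatrix}x\\ n\end{bmatrix}=\frac{(q^{x-n+1};q)_n}{(q;q)_n}$. -}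

module Defs where

open import Algebra.Apartness.Bundles using (HeytingField; HeytingCommutativeRing)
open import Algebra.Bundles using (CommutativeRing; Semiring)
open import Algebra.Bundles.Raw using (RawRing)
import Algebra.Apartness.Properties.HeytingCommutativeRing as HeytingProperties
import Algebra.Definitions.RawSemiring as RawSemiringDefs
import Algebra.Properties.Ring as RingProperties
import Algebra.Solver.Ring.NaturalCoefficients.Default as SemiringSolver
open import Data.Fin.Base as Fin using (Fin; toℕ)
open import Data.Nat.Base as ℕ using (ℕ; zero; suc; _∸_; _!; NonZero)
open import Data.Nat.Properties using (_!≢0)
open import Data.Product.Base using (∃; _,_; proj₁; proj₂)
open import Function.Base using (_∘_)
open import Level using (Level; _⊔_)
import Relation.Binary.Reasoning.Setoid as SetoidReasoning

-- A field of characteristic zero with an element q^e for every exponent e, and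
-- a notion of limit of sequences for which qⁿ tends to 0.  Instances: ℝ or ℂ
-- with 0 < q < 1 and real exponents; for q an indeterminate, generalised power
-- series in q with real exponents and q-adic limits.  Of the real
-- exponents only their addition and the element 1 are used, so exponents range
-- over any commutative ring.

record QField (c ℓ₁ ℓ₂ e ℓₑ ℓ₃ : Level) :
              Set (Level.suc (c ⊔ ℓ₁ ⊔ ℓ₂ ⊔ e ⊔ ℓₑ ⊔ ℓ₃)) where
  infix 4 _⟶_
  field
    field′    : HeytingField c ℓ₁ ℓ₂
    exponents : CommutativeRing e ℓₑ

  open HeytingField field′ public hiding (zero)
  open CommutativeRing exponents public using ()
    renaming ( Carrier to Exponent; _≈_ to _≈ₑ_; _+_ to _+ₑ_; _-_ to _-ₑ_
             ; 0# to 0ₑ; 1# to 1ₑ )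
  open RawSemiringDefs
    (Semiring.rawSemiring (CommutativeRing.semiring
      (HeytingCommutativeRing.commutativeRing heytingCommutativeRing)))
    public using (_^_; sum; product) renaming (_×_ to _·_)

  field
    q^⟨_⟩    : Exponent → Carrier
    q^-cong  : ∀ {a b} → a ≈ₑ b → q^⟨ a ⟩ ≈ q^⟨ b ⟩
    q^-homo  : ∀ a b → q^⟨ a +ₑ b ⟩ ≈ q^⟨ a ⟩ * q^⟨ b ⟩
    q^-zero  : q^⟨ 0ₑ ⟩ ≈ 1#

  q : Carrier
  q = q^⟨ 1ₑ ⟩

  field
    q-no-root-of-unity : ∀ n → .{{NonZero n}} → (q ^ n) # 1#
    characteristic-0   : ∀ n → .{{NonZero n}} → (n · 1#) # 0#

    _⟶_      : (ℕ → Carrier) → Carrier → Set ℓ₃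
    ⟶-cong   : ∀ {s t a b} → (∀ n → s n ≈ t n) → a ≈ b → s ⟶ a → t ⟶ b
    ⟶-unique : ∀ {s a b} → s ⟶ a → s ⟶ b → a ≈ b
    ⟶-const  : ∀ a → (λ _ → a) ⟶ a
    ⟶-+      : ∀ {s t a b} → s ⟶ a → t ⟶ b → (λ n → s n + t n) ⟶ a + b
    ⟶-*      : ∀ {s t a b} → s ⟶ a → t ⟶ b → (λ n → s n * t n) ⟶ a * b
    ⟶-tail   : ∀ {s a} → s ⟶ a → (s ∘ suc) ⟶ a
    ⟶-untail : ∀ {s a} → (s ∘ suc) ⟶ a → s ⟶ a
    q^n⟶0    : (λ n → q ^ n) ⟶ 0#

module PowerSeries {c ℓ} (R : RawRing c ℓ) where
  open RawRing R
  open RawSemiringDefs rawSemiring using (sum)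

  Series : Set c
  Series = ℕ → Carrier

  const : Carrier → Series
  const a zero    = a
  const a (suc _) = 0#

  var : Series
  var (suc zero) = 1#
  var _          = 0#

  seriesRing : RawRing c ℓ
  seriesRing = record
    { Carrier = Series
    ; _≈_     = λ f g → ∀ n → f n ≈ g n
    ; _+_     = λ f g n → f n + g n
    ; _*_     = λ f g n → sum {suc n} (λ i → f (toℕ i) * g (n ∸ toℕ i))
    ; -_      = λ f n → - f n
    ; 0#      = λ _ → 0#
    ; 1#      = const 1#
    }

  private
    module S  = RawRing seriesRing
    module SD = RawSemiringDefs S.rawSemiring

  -- For g with constant term 1, 1/g is the geometric series in 1 - g, of
  -- which only the first n + 1 terms affect the n-th coefficient.
  recip : Series → Series
  recip g n = SD.sum {suc n} (λ k → (S.1# S.+ (S.- g)) SD.^ toℕ k) n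

module QEulerian {c ℓ₁ ℓ₂ e ℓₑ ℓ₃} (𝕂 : QField c ℓ₁ ℓ₂ e ℓₑ ℓ₃) where
  open QField 𝕂 public

  private
    ring-K = HeytingCommutativeRing.commutativeRing heytingCommutativeRing
    module K = CommutativeRing ring-K
    open HeytingProperties heytingCommutativeRing
    open RingProperties K.ring using (-‿distribˡ-*; -1*x≈-x)

  ι : ℕ → Exponent
  ι n = n ×ₑ 1ₑ
    where
    open RawSemiringDefs (Semiring.rawSemiring (CommutativeRing.semiring exponents))
      renaming (_×_ to _×ₑ_)

  ∑≤ : ℕ → (ℕ → Carrier) → Carrier
  ∑≤ n f = sum {suc n} (f ∘ toℕ)

  infix 9 _⁻¹⟨_⟩
  _⁻¹⟨_⟩ : (a : Carrier) → a # 0# → Carrier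
  a ⁻¹⟨ a#0 ⟩ = proj₁ (#⇒invertible a#0)

  private
    #⇒-#0 : ∀ {a b} → a # b → (a - b) # 0#
    #⇒-#0 {a} {b} a#b with #⇒invertible a#b
    ... | i , i*d≈1 , _ = invertibleˡ⇒# (i , trans (*-congˡ (x-0≈x (a - b))) i*d≈1)

  1-q^n#0 : ∀ n → .{{NonZero n}} → (1# - q ^ n) # 0#
  1-q^n#0 n = #⇒-#0 (#-sym (q-no-root-of-unity n))

  1-q#0 : (1# - q) # 0#
  1-q#0 = #-congʳ (+-congˡ (K.-‿cong (*-identityʳ q))) (1-q^n#0 1)

  q-1#0 : (q - 1#) # 0#
  q-1#0 = #-congʳ (+-congʳ (*-identityʳ q)) (#⇒-#0 (q-no-root-of-unity 1))

  [_] : Exponent → Carrier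
  [ a ] = (1# - q^⟨ a ⟩) * (1# - q) ⁻¹⟨ 1-q#0 ⟩

  -- (a;q)_n for a in the field
  qPoch : Carrier → ℕ → Carrier
  qPoch a n = product {n} (λ i → 1# - a * q ^ toℕ i)

  private
    product#0 : ∀ n (f : Fin n → Carrier) → (∀ i → f i # 0#) → product f # 0#
    product#0 zero    f f#0 = 1#0
    product#0 (suc n) f f#0 =
      x#0y#0→xy#0 (f#0 Fin.zero) (product#0 n (f ∘ Fin.suc) (f#0 ∘ Fin.suc))

  qPoch#0 : ∀ n → qPoch q n # 0#
  qPoch#0 n = product#0 n _ (λ i → 1-q^n#0 (suc (toℕ i)))

  ⟦_choose_⟧ : Exponent → ℕ → Carrier
  ⟦ a choose n ⟧ = qPoch q^⟨ a -ₑ ι n +ₑ 1ₑ ⟩ n * qPoch q n ⁻¹⟨ qPoch#0 n ⟩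

  -- The values with k > n come out as 0; for k = 0 the term with E n (k - 1)
  -- is absent.
  E : (α β : Exponent) → ℕ → ℕ → Carrier
  E α β zero    zero    = 1#
  E α β zero    (suc k) = 0#
  E α β (suc n) zero    = [ ι zero +ₑ β ] * E α β n zero
  E α β (suc n) (suc k) =
      q^⟨ β +ₑ ι (suc k) -ₑ 1ₑ ⟩ * [ ι (suc n) -ₑ ι (suc k) +ₑ α ] * E α β n k
    + [ ι (suc k) +ₑ β ] * E α β n (suc k)

  module K⟦x⟧ = PowerSeries K.rawRing
  open K⟦x⟧ public using () renaming
    (Series to Seriesˣ; const to constˣ; var to X; recip to recipˣ)
  open RawRing K⟦x⟧.seriesRing public using () renaming
    (_≈_ to _≈ˣ_; _+_ to _+ˣ_; _*_ to _*ˣ_; -_ to -ˣ_; 1# to 1ˣ)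
  open RawSemiringDefs (RawRing.rawSemiring K⟦x⟧.seriesRing) public using () renaming
    (sum to sumˣ; product to productˣ; _^_ to _^ˣ_)

  module K⟦x⟧⟦t⟧ = PowerSeries K⟦x⟧.seriesRing
  open K⟦x⟧⟦t⟧ public using () renaming
    (Series to Seriesˣᵗ; const to constᵗ; var to T)
  open RawRing K⟦x⟧⟦t⟧.seriesRing public using () renaming (_*_ to _*ˣᵗ_)
  open RawSemiringDefs (RawRing.rawSemiring K⟦x⟧⟦t⟧.seriesRing) public using () renaming
    (sum to sumˣᵗ; _^_ to _^ˣᵗ_)

  infix 4 _⟶ˣ_ _⟶ˣᵗ_ _sumsToˣ_ _sumsToˣᵗ_

  _⟶ˣ_ : (ℕ → Seriesˣ) → Seriesˣ → Set ℓ₃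
  s ⟶ˣ f = ∀ k → (λ n → s n k) ⟶ f k

  _⟶ˣᵗ_ : (ℕ → Seriesˣᵗ) → Seriesˣᵗ → Set ℓ₃
  s ⟶ˣᵗ f = ∀ k → (λ n → s n k) ⟶ˣ f k

  -- Σ_{j≥0} u j as a limit of partial sums, coefficient by coefficient
  _sumsToˣ_ : (ℕ → Seriesˣ) → Seriesˣ → Set ℓ₃
  u sumsToˣ f = (λ n → sumˣ {n} (u ∘ toℕ)) ⟶ˣ f

  _sumsToˣᵗ_ : (ℕ → Seriesˣᵗ) → Seriesˣᵗ → Set ℓ₃
  u sumsToˣᵗ f = (λ n → sumˣᵗ {n} (u ∘ toℕ)) ⟶ˣᵗ f

  -- The constant term of p(qx) - p(x) vanishes; dividing by x shifts coefficients.
  δ : Seriesˣ → Seriesˣ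
  δ p k = (p⟨qx⟩ +ˣ -ˣ p) (suc k) * (q - 1#) ⁻¹⟨ q-1#0 ⟩
    where
    p⟨qx⟩ : Seriesˣ
    p⟨qx⟩ i = q ^ i * p i

  Eₓ : (α β : Exponent) → ℕ → Seriesˣ
  Eₓ α β n = sumˣ {suc n} (λ k → constˣ (E α β n (toℕ k)) *ˣ X ^ˣ toℕ k)

  n!#0 : ∀ n → ((n !) · 1#) # 0#
  n!#0 n = characteristic-0 (n !) {{n !≢0}}

  1/_! : ℕ → Carrier
  1/ n ! = ((n !) · 1#) ⁻¹⟨ n!#0 n ⟩

  -- exp(at) = Σ_n aⁿ tⁿ / n!, with coefficients constant in x
  exp⟨_t⟩ : Carrier → Seriesˣᵗ
  exp⟨ a t⟩ n = constˣ (a ^ n * 1/ n !)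

  -- (ax;q)_n = ∏_{i<n} (1 - a x qⁱ) as a polynomial in x
  qPochˣ : Carrier → ℕ → Seriesˣ
  qPochˣ a n = productˣ {n} (λ i → 1ˣ +ˣ -ˣ (constˣ (a * q ^ toℕ i) *ˣ X))

  private
    open SetoidReasoning K.setoid
    open SemiringSolver K.commutativeSemiring using (solve; _:=_; _:+_; _:*_)

    sum-0 : ∀ n (f : Fin n → Carrier) → (∀ i → f i ≈ 0#) → sum f ≈ 0#
    sum-0 zero    f f≈0 = refl
    sum-0 (suc n) f f≈0 =
      trans (+-cong (f≈0 Fin.zero) (sum-0 n (f ∘ Fin.suc) (f≈0 ∘ Fin.suc))) (+-identityˡ 0#)

    const-* : ∀ a f n → (constˣ a *ˣ f) n ≈ a * f n
    const-* a f n =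
      trans (+-congˡ (sum-0 n _ (λ _ → zeroˡ _))) (+-identityʳ _)

    factor : Carrier → Seriesˣ
    factor a = 1ˣ +ˣ -ˣ (constˣ a *ˣ X)

    factor₀ : ∀ a → factor a 0 ≈ 1#
    factor₀ a = begin
      1# - (constˣ a *ˣ X) 0  ≈⟨ +-congˡ (K.-‿cong (trans (const-* a X 0) (zeroʳ a))) ⟩
      1# - 0#                 ≈⟨ x-0≈x 1# ⟩
      1#                      ∎

    factor₁ : ∀ a → factor a 1 ≈ - a
    factor₁ a = begin
      0# - (constˣ a *ˣ X) 1  ≈⟨ +-identityˡ _ ⟩
      - (constˣ a *ˣ X) 1     ≈⟨ K.-‿cong (trans (const-* a X 1) (*-identityʳ a)) ⟩
      - a                     ∎

    factor₂ : ∀ a n → factor a (suc (suc n)) ≈ 0#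
    factor₂ a n = begin
      0# - (constˣ a *ˣ X) (suc (suc n))
        ≈⟨ +-congˡ (K.-‿cong (trans (const-* a X (suc (suc n))) (zeroʳ a))) ⟩
      0# - 0#  ≈⟨ x-0≈x 0# ⟩
      0#       ∎

    factor-*₀ : ∀ a f → (factor a *ˣ f) 0 ≈ f 0
    factor-*₀ a f = begin
      factor a 0 * f 0 + 0#  ≈⟨ +-identityʳ _ ⟩
      factor a 0 * f 0       ≈⟨ *-congʳ (factor₀ a) ⟩
      1# * f 0               ≈⟨ *-identityˡ _ ⟩
      f 0                    ∎

    factor-*₁ : ∀ a f n → (factor a *ˣ f) (suc n) ≈ f (suc n) + - a * f n
    factor-*₁ a f n = +-cong
      (trans (*-congʳ (factor₀ a)) (*-identityˡ _))
      (trans (+-cong (*-congʳ (factor₁ a))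
                     (sum-0 n _ (λ i → trans (*-congʳ (factor₂ a (toℕ i))) (zeroˡ _))))
             (+-identityʳ _))

    product-cong : ∀ n {a b : Fin n → Carrier} → (∀ i → a i ≈ b i) →
                   productˣ (factor ∘ a) ≈ˣ productˣ (factor ∘ b)
    product-cong zero    a≈b k               = refl
    product-cong (suc n) {a} {b} a≈b zero    =
      trans (factor-*₀ (a Fin.zero) (productˣ (factor ∘ a ∘ Fin.suc)))
      (trans (product-cong n (a≈b ∘ Fin.suc) 0)
             (sym (factor-*₀ (b Fin.zero) (productˣ (factor ∘ b ∘ Fin.suc)))))
    product-cong (suc n) {a} {b} a≈b (suc k) =
      trans (factor-*₁ (a Fin.zero) (productˣ (factor ∘ a ∘ Fin.suc)) k)
      (trans (+-cong (product-cong n (a≈b ∘ Fin.suc) (suc k))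
                     (*-cong (K.-‿cong (a≈b Fin.zero)) (product-cong n (a≈b ∘ Fin.suc) k)))
             (sym (factor-*₁ (b Fin.zero) (productˣ (factor ∘ b ∘ Fin.suc)) k)))

    rest : Carrier → ℕ → Seriesˣ
    rest a n = productˣ {n} (λ i → factor (a * q ^ suc (toℕ i)))

    shift : ∀ a n → rest a n ≈ˣ qPochˣ (a * q) n
    shift a n = product-cong n {λ i → a * q ^ suc (toℕ i)} {λ i → a * q * q ^ toℕ i} (λ i → sym (*-assoc a q (q ^ toℕ i)))

    poch₀ : ∀ a n → qPochˣ a n 0 ≈ 1#
    poch₀ a zero    = refl
    poch₀ a (suc n) = trans (factor-*₀ (a * 1#) (rest a n)) (trans (shift a n 0) (poch₀ (a * q) n))

    step : ∀ a n k → qPochˣ a (suc n) (suc k) ≈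
                     qPochˣ (a * q) n (suc k) + - a * qPochˣ (a * q) n k
    step a n k = trans (factor-*₁ (a * 1#) (rest a n) k)
      (+-cong (shift a n (suc k)) (*-cong (K.-‿cong (*-identityʳ a)) (shift a n k)))

    scale : ∀ a n k → qPochˣ (a * q) n k ≈ q ^ k * qPochˣ a n k
    scale a n       zero    =
      trans (poch₀ (a * q) n) (sym (trans (*-identityˡ _) (poch₀ a n)))
    scale a zero    (suc k) = sym (zeroʳ _)
    scale a (suc n) (suc k) = begin
      qPochˣ (a * q) (suc n) (suc k)
        ≈⟨ step (a * q) n k ⟩
      qPochˣ (a * q * q) n (suc k) + - (a * q) * qPochˣ (a * q * q) n k
        ≈⟨ +-cong (scale (a * q) n (suc k))
                  (*-cong (-‿distribˡ-* a q) (scale (a * q) n k)) ⟩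
      q ^ suc k * P₁ + - a * q * (q ^ k * P₀)
        ≈⟨ solve 5 (λ m q Q u v → q :* Q :* u :+ m :* q :* (Q :* v) := q :* Q :* (u :+ m :* v))
                 refl (- a) q (q ^ k) P₁ P₀ ⟩
      q ^ suc k * (P₁ + - a * P₀)
        ≈⟨ *-congˡ (step a n k) ⟨
      q ^ suc k * qPochˣ a (suc n) (suc k) ∎
      where
      P₁ P₀ : Carrier
      P₁ = qPochˣ (a * q) n (suc k)
      P₀ = qPochˣ (a * q) n k

    left : ∀ a n k → qPochˣ a (suc n) (suc k) ≈
                     q ^ suc k * qPochˣ a n (suc k) + - a * (q ^ k * qPochˣ a n k)
    left a n k = trans (step a n k) (+-cong (scale a n (suc k)) (*-congˡ (scale a n k)))

    right : ∀ a n k → qPochˣ a (suc n) (suc k) ≈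
                      qPochˣ a n (suc k) + - a * (q ^ n * qPochˣ a n k)
    right a zero zero = trans (left a 0 0) (+-congʳ (zeroʳ _))
    right a zero (suc k) = trans (left a 0 (suc k))
      (+-cong (zeroʳ _) (*-congˡ (trans (zeroʳ _) (sym (zeroʳ _)))))
    right a (suc n) zero = begin
      qPochˣ a (suc (suc n)) 1
        ≈⟨ left a (suc n) 0 ⟩
      q ^ 1 * qPochˣ a (suc n) 1 + - a * (1# * qPochˣ a (suc n) 0)
        ≈⟨ +-cong (*-congˡ (right a n 0)) (*-congˡ (*-congˡ (poch₀ a (suc n)))) ⟩
      q ^ 1 * (u + - a * (q ^ n * v)) + - a * (1# * 1#)
        ≈⟨ +-congʳ (*-congˡ (+-congˡ (*-congˡ (*-congˡ (poch₀ a n))))) ⟩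
      q ^ 1 * (u + - a * (q ^ n * 1#)) + - a * (1# * 1#)
        ≈⟨ +-cong (*-congʳ (*-identityʳ q)) refl ⟩
      q * (u + - a * (q ^ n * 1#)) + - a * (1# * 1#)
        ≈⟨ solve 5 (λ m q Q u e → q :* (u :+ m :* (Q :* e)) :+ m :* (e :* e)
                               := q :* u :+ m :* (e :* e) :+ m :* (q :* Q :* e))
                 refl (- a) q (q ^ n) u 1# ⟩
      q * u + - a * (1# * 1#) + - a * (q ^ suc n * 1#)
        ≈⟨ +-cong (+-cong (*-congʳ (*-identityʳ q)) (*-congˡ (*-congˡ (poch₀ a n))))
                  (*-congˡ (*-congˡ (poch₀ a (suc n)))) ⟨
      q ^ 1 * u + - a * (1# * v) + - a * (q ^ suc n * qPochˣ a (suc n) 0)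
        ≈⟨ +-congʳ (left a n 0) ⟨
      qPochˣ a (suc n) 1 + - a * (q ^ suc n * qPochˣ a (suc n) 0) ∎
      where
      u v : Carrier
      u = qPochˣ a n 1
      v = qPochˣ a n 0
    right a (suc n) (suc k) = begin
      qPochˣ a (suc (suc n)) (suc (suc k))
        ≈⟨ left a (suc n) (suc k) ⟩
      q ^ suc (suc k) * qPochˣ a (suc n) (suc (suc k))
        + - a * (q ^ suc k * qPochˣ a (suc n) (suc k))
        ≈⟨ +-cong (*-congˡ (right a n (suc k))) (*-congˡ (*-congˡ (right a n k))) ⟩
      q ^ suc (suc k) * (u + - a * (q ^ n * v)) + - a * (q ^ suc k * (v + - a * (q ^ n * w)))
        ≈⟨ solve 7 (λ m q Q R u v w →
               q :* (q :* Q) :* (u :+ m :* (R :* v)) :+ m :* (q :* Q :* (v :+ m :* (R :* w)))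
            := (q :* (q :* Q) :* u :+ m :* (q :* Q :* v))
               :+ m :* (q :* R :* (q :* Q :* v :+ m :* (Q :* w))))
             refl (- a) q (q ^ k) (q ^ n) u v w ⟩
      (q ^ suc (suc k) * u + - a * (q ^ suc k * v))
        + - a * (q ^ suc n * (q ^ suc k * v + - a * (q ^ k * w)))
        ≈⟨ +-cong (left a n (suc k)) (*-congˡ (*-congˡ (left a n k))) ⟨
      qPochˣ a (suc n) (suc (suc k)) + - a * (q ^ suc n * qPochˣ a (suc n) (suc k)) ∎
      where
      u v w : Carrier
      u = qPochˣ a n (suc (suc k))
      v = qPochˣ a n (suc k)
      w = qPochˣ a n k

    ratio : Carrier → ℕ → Carrier → Carrier → Carrier
    ratio a k z p = (1# - q ^ suc k) ⁻¹⟨ 1-q^n#0 (suc k) ⟩ * (- a * ((q ^ k - z) * p))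

    ratio-law : ∀ a n k → qPochˣ a n (suc k) ≈ ratio a k (q ^ n) (qPochˣ a n k)
    ratio-law a n k = begin
      u                        ≈⟨ *-identityˡ u ⟨
      1# * u                   ≈⟨ *-congʳ i*d≈1 ⟨
      i * (d - 0#) * u         ≈⟨ *-assoc _ _ _ ⟩
      i * ((d - 0#) * u)       ≈⟨ *-congˡ (*-congʳ (x-0≈x d)) ⟩
      i * (d * u)              ≈⟨ *-congˡ d*u ⟩
      i * (- a * ((q ^ k - q ^ n) * v)) ∎
      where
      i d u v : Carrier
      d = 1# - q ^ suc k
      i = d ⁻¹⟨ 1-q^n#0 (suc k) ⟩
      u = qPochˣ a n (suc k)
      v = qPochˣ a n k

      i*d≈1 : i * (d - 0#) ≈ 1#
      i*d≈1 = proj₁ (proj₂ (#⇒invertible (1-q^n#0 (suc k))))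

      open RingProperties K.ring using (+-cancelʳ)

      d*u : d * u ≈ - a * ((q ^ k - q ^ n) * v)
      d*u = +-cancelʳ (q ^ suc k * u + - a * (q ^ n * v)) _ _ (begin
        d * u + (Q * u + - a * (R * v))
          ≈⟨ solve 6 (λ e mQ Q u m Rv → (e :+ mQ) :* u :+ (Q :* u :+ m :* Rv)
                                     := (e :* u :+ m :* Rv) :+ (mQ :+ Q) :* u)
                   refl 1# (- Q) Q u (- a) (R * v) ⟩
        (1# * u + - a * (R * v)) + (- Q + Q) * u
          ≈⟨ +-cong (+-congʳ (*-identityˡ u)) (trans (*-congʳ (K.-‿inverseˡ Q)) (zeroˡ u)) ⟩
        (u + - a * (R * v)) + 0#
          ≈⟨ +-cong (trans (sym (right a n k)) (left a n k))
                    (sym (trans (*-congˡ (trans (*-congʳ (K.-‿inverseˡ R)) (zeroˡ v))) (zeroʳ (- a)))) ⟩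
        (Q * u + - a * (q ^ k * v)) + - a * ((- R + R) * v)
          ≈⟨ solve 6 (λ Qu m p mR R v → (Qu :+ m :* (p :* v)) :+ m :* ((mR :+ R) :* v)
                                     := m :* ((p :+ mR) :* v) :+ (Qu :+ m :* (R :* v)))
                   refl (Q * u) (- a) (q ^ k) (- R) R v ⟩
        - a * ((q ^ k - R) * v) + (Q * u + - a * (R * v)) ∎)
        where
        Q R : Carrier
        Q = q ^ suc k
        R = q ^ n

  -- Limits of sequences are unique (⟶-unique), so this determines (ax;q)_∞.
  infinite-product : ∀ a → ∃ λ P → (λ n → qPochˣ a n) ⟶ˣ P
  infinite-product a = P , limit
    where
    P : Seriesˣ
    P zero    = 1#
    P (suc k) = ratio a k 0# (P k)

    limit : (λ n → qPochˣ a n) ⟶ˣ P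
    limit zero    = ⟶-cong (λ n → sym (poch₀ a n)) refl (⟶-const 1#)
    limit (suc k) = ⟶-cong (λ n → sym (ratio-law a n k)) refl
      (⟶-* (⟶-const _) (⟶-* (⟶-const _) (⟶-* q^k-q^n (limit k))))
      where
      q^k-q^n : (λ n → q ^ k - q ^ n) ⟶ q ^ k - 0#
      q^k-q^n = ⟶-+ (⟶-const _)
        (⟶-cong (λ n → -1*x≈-x (q ^ n)) (-1*x≈-x 0#) (⟶-* (⟶-const (- 1#)) q^n⟶0))

  qPochˣ∞ : Carrier → Seriesˣ
  qPochˣ∞ a = proj₁ (infinite-product a)

  -- (x;q)_N = (x;q)_∞ / (x q^N;q)_∞ for an arbitrary exponent N
  qPochʳ : Exponent → Seriesˣ
  qPochʳ N = qPochˣ∞ 1# *ˣ recipˣ (qPochˣ∞ q^⟨ N ⟩)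

{-# OPTIONS --safe #-}
module Submission where

-- For given a and b there is exactly one power series f with f(0) = 1 and
-- (1 - a x) f(x) = (1 - b x) f(q x), namely (b x;q)_∞ / (a x;q)_∞.  Multiplying
-- the functional equations for (a, b) and (b, c) gives the one for (a, c), so
-- expansions of (x;q)_N and 1/(x;q)_N, and the relations between different N,
-- need only be checked on coefficient recurrences.
--
-- With (σ f)(x) = f(q x), the recursion for E_{n,k} reads
--   (1 - q) E_{n+1} = (1 - q^{n+α+β} x) E_n - q^β (1 - x) σ E_n,
-- and dividing by (x;q)_{n+1+α+β} turns it, for F_n = E_n / (x;q)_{n+α+β}, into
--   (1 - q) F_{n+1} = F_n - q^β σ F_n,
-- which multiplies the coefficient of x^j by [j + β].

open import Algebra.Apartness.Bundles using (HeytingCommutativeRing)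
open import Algebra.Bundles using (CommutativeRing; Semiring)
open import Algebra.Bundles.Raw using (RawRing)
open import Algebra.Solver.Ring.AlmostCommutativeRing
  using (_-Raw-AlmostCommutative⟶_; fromCommutativeRing)
open import Algebra.Structures using (IsCommutativeRing)
open import Data.Fin.Base as Fin using (Fin; toℕ)
open import Data.Fin.Properties using (toℕ≤pred[n])
open import Data.Integer.Base as ℤ using (ℤ; +_; -[1+_])
open import Data.Maybe.Base using (Maybe; map)
open import Data.Nat.Base as ℕ using (ℕ; zero; suc; _∸_; _≤_; _<_; z≤n; s≤s; s<s)
open import Data.Nat.Combinatorics using (_C_; nC1≡n; nCk+nC[k+1]≡[n+1]C[k+1])
open import Data.Product.Base using (∃; _×_; _,_; proj₁; proj₂)
open import Data.Sum.Base using (inj₁; inj₂)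
open import Defs
open import Function.Base using (_∘_)
open import Relation.Binary.PropositionalEquality.Core as ≡ using (_≡_; _≢_)
open import Relation.Nullary.Decidable.Core using (Dec; yes; no; dec⇒maybe)
open import Relation.Nullary.Negation.Core using (contradiction)
import Algebra.Apartness.Properties.HeytingCommutativeRing as HeytingProperties
import Algebra.Definitions.RawSemiring as RawSemiringDefs
import Algebra.Properties.AbelianGroup as AbelianGroupProperties
import Algebra.Properties.Ring as RingProperties
import Algebra.Properties.Semiring.Exp as SemiringExp
import Algebra.Properties.Semiring.Mult.TCOptimised as SemiringMult
import Algebra.Properties.Semiring.Sum as SemiringSum
import Algebra.Solver.CommutativeMonoid as CommutativeMonoidSolver
import Algebra.Solver.Ring as RingSolver
import Data.Integer.Properties as ℤ
import Data.Nat.Properties as ℕ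
import Relation.Binary.Reasoning.Setoid as SetoidReasoning

-- Integer coefficients for the ring solver.

-- The ring solver only cancels x - x if it can decide equality of its
-- coefficients, hence integer coefficients.
module IntegerCoefficients {c ℓ} (R : CommutativeRing c ℓ) where
  open CommutativeRing R
  open AbelianGroupProperties +-abelianGroup
    using (⁻¹-∙-comm; ⁻¹-involutive) renaming (ε⁻¹≈ε to -0≈0)
  open RingProperties ring using (-‿distribˡ-*; -‿distribʳ-*)
  open SemiringMult semiring using (1+×; ×-homo-+; ×1-homo-*) renaming (_×_ to _·_)
  open SetoidReasoning setoid

  private
    -- With the optimised multiple, 1 · 1# is 1# by computation, so the constants `:0` and `:1`
    -- denote exactly 0# and 1#.
    ⟦_⟧ℤ : ℤ → Carrier
    ⟦ + n ⟧ℤ      = n · 1#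
    ⟦ -[1+ n ] ⟧ℤ = - (suc n · 1#)

    neg-homo : ∀ i → ⟦ ℤ.- i ⟧ℤ ≈ - ⟦ i ⟧ℤ
    neg-homo (+ zero)   = sym -0≈0
    neg-homo (+ suc n)  = refl
    neg-homo -[1+ n ]   = sym (⁻¹-involutive _)

    ⊖-homo : ∀ m n → ⟦ m ℤ.⊖ n ⟧ℤ ≈ m · 1# - n · 1#
    ⊖-homo m zero          = sym (trans (+-congˡ -0≈0) (+-identityʳ _))
    ⊖-homo zero (suc n)    = sym (+-identityˡ _)
    ⊖-homo (suc m) (suc n) = begin
      ⟦ suc m ℤ.⊖ suc n ⟧ℤ             ≡⟨ ≡.cong ⟦_⟧ℤ (ℤ.[1+m]⊖[1+n]≡m⊖n m n) ⟩
      ⟦ m ℤ.⊖ n ⟧ℤ                     ≈⟨ ⊖-homo m n ⟩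
      m · 1# - n · 1#                  ≈⟨ +-congʳ (+-identityˡ _) ⟨
      0# + m · 1# - n · 1#             ≈⟨ +-congʳ (+-congʳ (-‿inverseʳ 1#)) ⟨
      1# - 1# + m · 1# - n · 1#
        ≈⟨ solve 4 (λ x y z w → ((x ⊕ y) ⊕ z) ⊕ w ⊜ (x ⊕ z) ⊕ (y ⊕ w))
             refl 1# (- 1#) (m · 1#) (- (n · 1#)) ⟩
      1# + m · 1# + (- 1# - n · 1#)    ≈⟨ +-cong (sym (1+× m 1#)) (⁻¹-∙-comm 1# _) ⟩
      suc m · 1# - (1# + n · 1#)       ≈⟨ +-congˡ (-‿cong (1+× n 1#)) ⟨
      suc m · 1# - suc n · 1#          ∎
      where open CommutativeMonoidSolver +-commutativeMonoid using (solve; _⊕_; _⊜_)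

    +-homo : ∀ i j → ⟦ i ℤ.+ j ⟧ℤ ≈ ⟦ i ⟧ℤ + ⟦ j ⟧ℤ
    +-homo (+ m)    (+ n)    = ×-homo-+ 1# m n
    +-homo (+ m)    -[1+ n ] = ⊖-homo m (suc n)
    +-homo -[1+ m ] (+ n)    = trans (⊖-homo n (suc m)) (+-comm _ _)
    +-homo -[1+ m ] -[1+ n ] = begin
      - (suc (suc m ℕ.+ n) · 1#)        ≡⟨ ≡.cong (λ k → - (k · 1#)) (ℕ.+-suc (suc m) n) ⟨
      - ((suc m ℕ.+ suc n) · 1#)        ≈⟨ -‿cong (×-homo-+ 1# (suc m) (suc n)) ⟩
      - (suc m · 1# + suc n · 1#)       ≈⟨ ⁻¹-∙-comm _ _ ⟨
      - (suc m · 1#) - (suc n · 1#)     ∎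

    +*-homo : ∀ m j → ⟦ + m ℤ.* j ⟧ℤ ≈ ⟦ + m ⟧ℤ * ⟦ j ⟧ℤ
    +*-homo m (+ n)    = trans (reflexive (≡.cong ⟦_⟧ℤ (≡.sym (ℤ.pos-* m n)))) (×1-homo-* m n)
    +*-homo m -[1+ n ] = begin
      ⟦ + m ℤ.* -[1+ n ] ⟧ℤ         ≡⟨ ≡.cong ⟦_⟧ℤ (ℤ.neg-distribʳ-* (+ m) (+ suc n)) ⟨
      ⟦ ℤ.- (+ m ℤ.* + suc n) ⟧ℤ    ≈⟨ neg-homo (+ m ℤ.* + suc n) ⟩
      - ⟦ + m ℤ.* + suc n ⟧ℤ        ≈⟨ -‿cong (+*-homo m (+ suc n)) ⟩
      - (⟦ + m ⟧ℤ * ⟦ + suc n ⟧ℤ)   ≈⟨ -‿distribʳ-* _ _ ⟩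
      ⟦ + m ⟧ℤ * - ⟦ + suc n ⟧ℤ     ∎

    *-homo : ∀ i j → ⟦ i ℤ.* j ⟧ℤ ≈ ⟦ i ⟧ℤ * ⟦ j ⟧ℤ
    *-homo (+ m)    j = +*-homo m j
    *-homo -[1+ m ] j = begin
      ⟦ -[1+ m ] ℤ.* j ⟧ℤ           ≡⟨ ≡.cong ⟦_⟧ℤ (ℤ.neg-distribˡ-* (+ suc m) j) ⟨
      ⟦ ℤ.- (+ suc m ℤ.* j) ⟧ℤ      ≈⟨ neg-homo (+ suc m ℤ.* j) ⟩
      - ⟦ + suc m ℤ.* j ⟧ℤ          ≈⟨ -‿cong (+*-homo (suc m) j) ⟩
      - (⟦ + suc m ⟧ℤ * ⟦ j ⟧ℤ)     ≈⟨ -‿distribˡ-* _ _ ⟩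
      - ⟦ + suc m ⟧ℤ * ⟦ j ⟧ℤ       ∎

    homomorphism : ℤ.+-*-rawRing -Raw-AlmostCommutative⟶ fromCommutativeRing R
    homomorphism = record
      { ⟦_⟧    = ⟦_⟧ℤ
      ; +-homo = +-homo
      ; *-homo = *-homo
      ; -‿homo = neg-homo
      ; 0-homo = refl
      ; 1-homo = refl
      }

    _≟_ : ∀ i j → Maybe (⟦ i ⟧ℤ ≈ ⟦ j ⟧ℤ)
    i ≟ j = map (λ i≡j → reflexive (≡.cong ⟦_⟧ℤ i≡j)) (dec⇒maybe (i ℤ.≟ j))

  open RingSolver ℤ.+-*-rawRing (fromCommutativeRing R) homomorphism _≟_ public
    using (solve; _:=_; _:+_; _:*_; _:-_; :-_; con; Polynomial)

  :0 :1 : ∀ {n} → Polynomial n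
  :0 = con (+ 0)
  :1 = con (+ 1)

-- Finite sums and products.

module FiniteSums {c ℓ} (R : CommutativeRing c ℓ) where
  open CommutativeRing R
  open RawSemiringDefs (Semiring.rawSemiring semiring) using (sum; product; _^_)
  open SemiringSum semiring using (sum-cong-≋; sum-replicate-zero)
  open IntegerCoefficients R
  open SetoidReasoning setoid

  sum-zero : ∀ n (f : Fin n → Carrier) → (∀ i → f i ≈ 0#) → sum f ≈ 0#
  sum-zero n f f≈0 = trans (sum-cong-≋ f≈0) (sum-replicate-zero n)

  sum-single : ∀ n (f : ℕ → Carrier) k → k < n → (∀ j → j ≢ k → f j ≈ 0#) →
               sum {n} (f ∘ toℕ) ≈ f k
  sum-single (suc n) f zero    _         f≈0 =
    trans (+-congˡ (sum-zero n _ (λ i → f≈0 (suc (toℕ i)) λ ()))) (+-identityʳ _)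
  sum-single (suc n) f (suc k) (s<s k<n) f≈0 = trans
    (+-cong (f≈0 0 λ ())
            (sum-single n (f ∘ suc) k k<n (λ j j≢k → f≈0 (suc j) (j≢k ∘ ℕ.suc-injective))))
    (+-identityˡ _)

  sum-snoc : ∀ n (f : ℕ → Carrier) → sum {suc n} (f ∘ toℕ) ≈ sum {n} (f ∘ toℕ) + f n
  sum-snoc zero    f = +-comm (f 0) 0#
  sum-snoc (suc n) f = trans (+-congˡ (sum-snoc n (f ∘ suc))) (sym (+-assoc _ _ _))

  product-cong : ∀ n {f g : ℕ → Carrier} → (∀ i → f i ≈ g i) →
                 product {n} (f ∘ toℕ) ≈ product {n} (g ∘ toℕ)
  product-cong zero    f≈g = refl
  product-cong (suc n) f≈g = *-cong (f≈g 0) (product-cong n (f≈g ∘ suc))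

  product-snoc : ∀ n (f : ℕ → Carrier) →
                 product {suc n} (f ∘ toℕ) ≈ product {n} (f ∘ toℕ) * f n
  product-snoc zero    f = *-comm (f 0) 1#
  product-snoc (suc n) f = trans (*-congˡ (product-snoc n (f ∘ suc))) (sym (*-assoc _ _ _))

  geometric-sum : ∀ u n → (1# - u) * sum {n} (λ i → u ^ toℕ i) ≈ 1# - u ^ n
  geometric-sum u zero    = solve 1 (λ u → (:1 :- u) :* :0 := :1 :- :1) refl u
  geometric-sum u (suc n) = begin
    (1# - u) * sum {suc n} (λ i → u ^ toℕ i)
      ≈⟨ *-congˡ (sum-snoc n (u ^_)) ⟩
    (1# - u) * (sum {n} (λ i → u ^ toℕ i) + u ^ n)
      ≈⟨ distribˡ _ _ _ ⟩
    (1# - u) * sum {n} (λ i → u ^ toℕ i) + (1# - u) * u ^ n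
      ≈⟨ +-congʳ (geometric-sum u n) ⟩
    1# - u ^ n + (1# - u) * u ^ n
      ≈⟨ solve 2 (λ u v → :1 :- v :+ (:1 :- u) :* v := :1 :- u :* v) refl u (u ^ n) ⟩
    1# - u ^ suc n ∎

module RingToolkit {c ℓ} (R : CommutativeRing c ℓ) where
  open CommutativeRing R public
  open FiniteSums R public
  open IntegerCoefficients R public
  open SetoidReasoning setoid public

-- The ring of formal power series and its reciprocals.

module PowerSeriesProperties {c ℓ} (R : CommutativeRing c ℓ) where
  open CommutativeRing R hiding (isCommutativeRing)
  open PowerSeries rawRing
  open SemiringSum semiring using (sum; sum-cong-≋)
  open FiniteSums R
  open IntegerCoefficients R
  open SetoidReasoning setoid

  open RawRing seriesRing public using () renaming
    (_≈_ to _≈ˢ_; _+_ to _+ˢ_; _*_ to _*ˢ_; -_ to -ˢ_; 0# to 0ˢ; 1# to 1ˢ)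
  private module SD = RawSemiringDefs (RawRing.rawSemiring seriesRing)

  sumˢ-coeff : ∀ n (u : Fin n → Series) k → SD.sum u k ≈ sum (λ i → u i k)
  sumˢ-coeff zero    u k = refl
  sumˢ-coeff (suc n) u k = +-congˡ (sumˢ-coeff n (u ∘ Fin.suc) k)

  -- Only coefficients up to degree n enter. This lets `recip-inverse` replace `recip g` by a
  -- partial sum that agrees with it only that far.
  *ˢ-cong≤ : ∀ n {f f′ g g′ : Series} →
             (∀ k → k ≤ n → f k ≈ f′ k) → (∀ k → k ≤ n → g k ≈ g′ k) →
             (f *ˢ g) n ≈ (f′ *ˢ g′) n
  *ˢ-cong≤ n f≈f′ g≈g′ = sum-cong-≋ {suc n} λ i →
    *-cong (f≈f′ (toℕ i) (toℕ≤pred[n] i)) (g≈g′ (n ∸ toℕ i) (ℕ.m∸n≤m n (toℕ i)))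

  *ˢ-cong : ∀ {f f′ g g′} → f ≈ˢ f′ → g ≈ˢ g′ → (f *ˢ g) ≈ˢ (f′ *ˢ g′)
  *ˢ-cong f≈f′ g≈g′ n = *ˢ-cong≤ n (λ k _ → f≈f′ k) (λ k _ → g≈g′ k)

  *ˢ-zeroˡ : ∀ f → (0ˢ *ˢ f) ≈ˢ 0ˢ
  *ˢ-zeroˡ f n = sum-zero (suc n) _ (λ i → zeroˡ (f (n ∸ toℕ i)))

  -- By computation (f g)(n+1) = f(0) g(n+1) + (f⁺ g)(n), where f⁺ drops the constant term; this
  -- peels the left factor only. Peeling f, commuting and peeling g leaves f⁺ g⁺ two degrees lower,
  -- hence the two base cases.
  *ˢ-comm : ∀ f g → (f *ˢ g) ≈ˢ (g *ˢ f)
  *ˢ-comm f g zero          = +-congʳ (*-comm _ _)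
  *ˢ-comm f g (suc zero)    =
    solve 4 (λ f₀ f₁ g₀ g₁ → f₀ :* g₁ :+ (f₁ :* g₀ :+ :0) := g₀ :* f₁ :+ (g₁ :* f₀ :+ :0))
      refl (f 0) (f 1) (g 0) (g 1)
  *ˢ-comm f g (suc (suc n)) = begin
    f 0 * g (2 ℕ.+ n) + (f⁺ *ˢ g) (suc n)
      ≈⟨ +-congˡ (*ˢ-comm f⁺ g (suc n)) ⟩
    f 0 * g (2 ℕ.+ n) + (g 0 * f (2 ℕ.+ n) + (g⁺ *ˢ f⁺) n)
      ≈⟨ +-congˡ (+-congˡ (*ˢ-comm g⁺ f⁺ n)) ⟩
    f 0 * g (2 ℕ.+ n) + (g 0 * f (2 ℕ.+ n) + (f⁺ *ˢ g⁺) n)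
      ≈⟨ solve 3 (λ x y z → x :+ (y :+ z) := y :+ (x :+ z)) refl _ _ _ ⟩
    g 0 * f (2 ℕ.+ n) + (f *ˢ g⁺) (suc n)
      ≈⟨ +-congˡ (*ˢ-comm g⁺ f (suc n)) ⟨
    g 0 * f (2 ℕ.+ n) + (g⁺ *ˢ f) (suc n) ∎
    where
    f⁺ g⁺ : Series
    f⁺ = f ∘ suc
    g⁺ = g ∘ suc

  *ˢ-distribʳ : ∀ f g h → ((g +ˢ h) *ˢ f) ≈ˢ ((g *ˢ f) +ˢ (h *ˢ f))
  *ˢ-distribʳ f g h zero    =
    solve 3 (λ x y z → (y :+ z) :* x :+ :0 := (y :* x :+ :0) :+ (z :* x :+ :0))
         refl (f 0) (g 0) (h 0)
  *ˢ-distribʳ f g h (suc n) = trans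
    (+-congˡ (*ˢ-distribʳ f (g ∘ suc) (h ∘ suc) n))
    (solve 5 (λ x y z u v → (y :+ z) :* x :+ (u :+ v) := (y :* x :+ u) :+ (z :* x :+ v))
      refl (f (suc n)) (g 0) (h 0) _ _)

  *ˢ-scaleˡ : ∀ a f g → ((λ k → a * f k) *ˢ g) ≈ˢ (λ k → a * (f *ˢ g) k)
  *ˢ-scaleˡ a f g zero    =
    solve 3 (λ a x y → a :* x :* y :+ :0 := a :* (x :* y :+ :0)) refl a (f 0) (g 0)
  *ˢ-scaleˡ a f g (suc n) = trans
    (+-congˡ (*ˢ-scaleˡ a (f ∘ suc) g n))
    (solve 4 (λ a x y z → a :* x :* y :+ a :* z := a :* (x :* y :+ z)) refl a (f 0) (g (suc n)) _)

  *ˢ-assoc : ∀ f g h → ((f *ˢ g) *ˢ h) ≈ˢ (f *ˢ (g *ˢ h))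
  *ˢ-assoc f g h zero    =
    solve 3 (λ x y z → (x :* y :+ :0) :* z :+ :0 := x :* (y :* z :+ :0) :+ :0)
         refl (f 0) (g 0) (h 0)
  *ˢ-assoc f g h (suc n) = begin
    (f 0 * g 0 + 0#) * h (suc n) + (((λ k → f 0 * g⁺ k) +ˢ (f⁺ *ˢ g)) *ˢ h) n
      ≈⟨ +-congˡ (*ˢ-distribʳ h (λ k → f 0 * g⁺ k) (f⁺ *ˢ g) n) ⟩
    (f 0 * g 0 + 0#) * h (suc n) + (((λ k → f 0 * g⁺ k) *ˢ h) n + ((f⁺ *ˢ g) *ˢ h) n)
      ≈⟨ +-congˡ (+-cong (*ˢ-scaleˡ (f 0) g⁺ h n) (*ˢ-assoc f⁺ g h n)) ⟩
    (f 0 * g 0 + 0#) * h (suc n) + (f 0 * (g⁺ *ˢ h) n + (f⁺ *ˢ (g *ˢ h)) n)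
      ≈⟨ solve 5 (λ x y z u v → (x :* y :+ :0) :* z :+ (x :* u :+ v) := x :* (y :* z :+ u) :+ v)
           refl (f 0) (g 0) (h (suc n)) _ _ ⟩
    f 0 * (g 0 * h (suc n) + (g⁺ *ˢ h) n) + (f⁺ *ˢ (g *ˢ h)) n ∎
    where
    f⁺ g⁺ : Series
    f⁺ = f ∘ suc
    g⁺ = g ∘ suc

  const-* : ∀ a f n → (const a *ˢ f) n ≈ a * f n
  const-* a f zero    = +-identityʳ _
  const-* a f (suc n) = trans (+-congˡ (*ˢ-zeroˡ f n)) (+-identityʳ _)

  *ˢ-identityˡ : ∀ f → (1ˢ *ˢ f) ≈ˢ f
  *ˢ-identityˡ f n = trans (const-* 1# f n) (*-identityˡ _)

  isCommutativeRing : IsCommutativeRing _≈ˢ_ _+ˢ_ _*ˢ_ -ˢ_ 0ˢ 1ˢ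
  isCommutativeRing = record
    { isRing = record
      { +-isAbelianGroup = record
        { isGroup = record
          { isMonoid = record
            { isSemigroup = record
              { isMagma = record
                { isEquivalence = record
                  { refl  = λ n → refl
                  ; sym   = λ f≈g n → sym (f≈g n)
                  ; trans = λ f≈g g≈h n → trans (f≈g n) (g≈h n)
                  }
                ; ∙-cong = λ f≈f′ g≈g′ n → +-cong (f≈f′ n) (g≈g′ n)
                }
              ; assoc = λ f g h n → +-assoc (f n) (g n) (h n)
              }
            ; identity = (λ f n → +-identityˡ (f n)) , (λ f n → +-identityʳ (f n))
            }
          ; inverse = (λ f n → -‿inverseˡ (f n)) , (λ f n → -‿inverseʳ (f n))
          ; ⁻¹-cong = λ f≈g n → -‿cong (f≈g n)
          }
        ; comm = λ f g n → +-comm (f n) (g n)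
        }
      ; *-cong     = *ˢ-cong
      ; *-assoc    = *ˢ-assoc
      ; *-identity = *ˢ-identityˡ , λ f n → trans (*ˢ-comm f 1ˢ n) (*ˢ-identityˡ f n)
      ; distrib    =
          (λ f g h n → trans (*ˢ-comm f (g +ˢ h) n)
            (trans (*ˢ-distribʳ f g h n) (+-cong (*ˢ-comm g f n) (*ˢ-comm h f n))))
        , *ˢ-distribʳ
      }
    ; *-comm = *ˢ-comm
    }

  commutativeRingˢ : CommutativeRing c ℓ
  commutativeRingˢ = record { isCommutativeRing = isCommutativeRing }

  module S = RingToolkit commutativeRingˢ
  open S using () renaming
    ( solve to solveˢ; _:=_ to _:=ˢ_; _:+_ to _:+ˢ_; _:*_ to _:*ˢ_
    ; _:-_ to _:-ˢ_; :1 to :1ˢ )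

  var-*₀ : ∀ f → (var *ˢ f) 0 ≈ 0#
  var-*₀ f = trans (+-identityʳ _) (zeroˡ _)

  var-*₊ : ∀ f n → (var *ˢ f) (suc n) ≈ f n
  var-*₊ f n = trans (+-congʳ (zeroˡ _))
    (trans (+-identityˡ _) (trans (*ˢ-cong {var ∘ suc} {1ˢ} {f} var⁺≈1 S.refl n) (*ˢ-identityˡ f n)))
    where
    var⁺≈1 : (var ∘ suc) ≈ˢ 1ˢ
    var⁺≈1 zero    = refl
    var⁺≈1 (suc n) = refl

  var^-*-shift : ∀ j f k → ((var SD.^ suc j) *ˢ f) (suc k) ≈ ((var SD.^ j) *ˢ f) k
  var^-*-shift j f k = trans (*ˢ-assoc var (var SD.^ j) f (suc k)) (var-*₊ ((var SD.^ j) *ˢ f) k)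

  var^-*-zero : ∀ j f → ((var SD.^ suc j) *ˢ f) 0 ≈ 0#
  var^-*-zero j f = trans (*ˢ-assoc var (var SD.^ j) f 0) (var-*₀ ((var SD.^ j) *ˢ f))

  monomial-same : ∀ j a → ((var SD.^ j) *ˢ const a) j ≈ a
  monomial-same zero    a = *ˢ-identityˡ (const a) 0
  monomial-same (suc j) a = trans (var^-*-shift j (const a) j) (monomial-same j a)

  monomial-other : ∀ j a k → j ≢ k → ((var SD.^ j) *ˢ const a) k ≈ 0#
  monomial-other zero    a zero    0≢0 = contradiction ≡.refl 0≢0
  monomial-other zero    a (suc k) _   = *ˢ-identityˡ (const a) (suc k)
  monomial-other (suc j) a zero    _   = var^-*-zero j (const a)
  monomial-other (suc j) a (suc k) j≢k =
    trans (var^-*-shift j (const a) k) (monomial-other j a k (j≢k ∘ ≡.cong suc))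

  const-cong : ∀ {a b} → a ≈ b → const a ≈ˢ const b
  const-cong a≈b zero    = a≈b
  const-cong a≈b (suc n) = refl

  const-*-const : ∀ a b → const (a * b) ≈ˢ (const a *ˢ const b)
  const-*-const a b zero    = sym (const-* a (const b) 0)
  const-*-const a b (suc n) = sym (trans (const-* a (const b) (suc n)) (zeroʳ a))

  const-- : ∀ a b → (const a +ˢ (-ˢ const b)) ≈ˢ const (a - b)
  const-- a b zero    = refl
  const-- a b (suc n) = -‿inverseʳ 0#

  -- A series without constant term is divisible by the variable, so its m-th power is divisible by
  -- the m-th power of the variable.
  ^-vanishes : ∀ u → u 0 ≈ 0# → ∀ m n → n < m → (u SD.^ m) n ≈ 0#
  ^-vanishes u u₀≈0 (suc m) n n<1+m =
    sum-zero (suc n) (λ i → u (toℕ i) * (u SD.^ m) (n ∸ toℕ i)) (term n n<1+m)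
    where
    term : ∀ n → n < suc m → (i : Fin (suc n)) → u (toℕ i) * (u SD.^ m) (n ∸ toℕ i) ≈ 0#
    term n       _           Fin.zero    = trans (*-congʳ u₀≈0) (zeroˡ _)
    term (suc n) (s<s 1+n≤m) (Fin.suc i) = trans
      (*-congˡ (^-vanishes u u₀≈0 m (n ∸ toℕ i) (ℕ.≤-<-trans (ℕ.m∸n≤m n (toℕ i)) 1+n≤m)))
      (zeroʳ _)

  partial-recip : Series → ℕ → Series
  partial-recip g n = SD.sum {n} (λ i → (1ˢ S.- g) SD.^ toℕ i)

  ≈1⇒1-≈0 : ∀ {a} → a ≈ 1# → 1# - a ≈ 0#
  ≈1⇒1-≈0 a≈1 = trans (+-congˡ (-‿cong a≈1)) (-‿inverseʳ 1#)

  -- `recip` cuts the geometric series at a different place in each degree. Any longer cut gives the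
  -- same coefficient, because the further powers of 1 - g start in higher degrees.
  recip-stable : ∀ g → g 0 ≈ 1# → ∀ k n → k < n → partial-recip g n k ≈ recip g k
  recip-stable g g₀≈1 k (suc n) k<1+n with ℕ.m≤n⇒m<n∨m≡n (ℕ.s≤s⁻¹ k<1+n)
  ... | inj₂ ≡.refl = refl
  ... | inj₁ k<n    = begin
    partial-recip g (suc n) k
      ≈⟨ S.sum-snoc n ((1ˢ S.- g) SD.^_) k ⟩
    partial-recip g n k + ((1ˢ S.- g) SD.^ n) k
      ≈⟨ +-cong (recip-stable g g₀≈1 k n k<n) (^-vanishes (1ˢ S.- g) (≈1⇒1-≈0 g₀≈1) n k k<n) ⟩
    recip g k + 0#
      ≈⟨ +-identityʳ _ ⟩
    recip g k ∎

  -- With u = 1 - g the product telescopes to 1 - u^(n+1), and u^(n+1) has no coefficient in degree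
  -- n.
  recip-inverse : ∀ g → g 0 ≈ 1# → (g *ˢ recip g) ≈ˢ 1ˢ
  recip-inverse g g₀≈1 n = begin
    (g *ˢ recip g) n
      ≈⟨ *ˢ-cong≤ n {g} {1ˢ S.- u} {recip g} {partial-recip g (suc n)}
         (λ k _ → solveˢ 1 (λ g → g :=ˢ :1ˢ :-ˢ (:1ˢ :-ˢ g)) S.refl g k)
                    (λ k k≤n → sym (recip-stable g g₀≈1 k (suc n) (s≤s k≤n))) ⟩
    ((1ˢ S.- u) *ˢ partial-recip g (suc n)) n
      ≈⟨ S.geometric-sum u (suc n) n ⟩
    1ˢ n - (u SD.^ suc n) n
      ≈⟨ +-congˡ (-‿cong (^-vanishes (1ˢ S.- g) (≈1⇒1-≈0 g₀≈1) (suc n) n ℕ.≤-refl)) ⟩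
    1ˢ n - 0#
      ≈⟨ solve 1 (λ x → x :- :0 := x) refl (1ˢ n) ⟩
    1ˢ n ∎
    where
    u : Series
    u = 1ˢ S.- g

  recip-unique : ∀ g h → g 0 ≈ 1# → (g *ˢ h) ≈ˢ 1ˢ → recip g ≈ˢ h
  recip-unique g h g₀≈1 gh≈1 = S.begin
    recip g             S.≈⟨ S.*-identityˡ (recip g) ⟨
    1ˢ *ˢ recip g       S.≈⟨ S.*-congʳ {recip g} gh≈1 ⟨
    g *ˢ h *ˢ recip g
      S.≈⟨ solveˢ 3 (λ g h r → (g :*ˢ h) :*ˢ r :=ˢ h :*ˢ (g :*ˢ r)) S.refl g h (recip g) ⟩
    h *ˢ (g *ˢ recip g) S.≈⟨ S.*-congˡ {h} (recip-inverse g g₀≈1) ⟩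
    h *ˢ 1ˢ             S.≈⟨ S.*-identityʳ h ⟩
    h                   S.∎

-- Inverses, limits, powers of q and q-brackets.

module QEulerianProperties {c ℓ₁ ℓ₂ e ℓₑ ℓ₃} (𝕂 : QField c ℓ₁ ℓ₂ e ℓₑ ℓ₃) where
  open QEulerian 𝕂
  ringK : CommutativeRing c ℓ₁
  ringK = HeytingCommutativeRing.commutativeRing heytingCommutativeRing

  private
    module K = CommutativeRing ringK
    module Kˣ = PowerSeriesProperties ringK
    module Kˣᵗ = PowerSeriesProperties Kˣ.commutativeRingˢ
    module R = Kˣ.S
    module Exp = RingToolkit exponents
  open HeytingProperties heytingCommutativeRing using (x-0≈x)
  open SemiringExp K.semiring using (^-congˡ; ^-homo-*)
  open SemiringSum K.semiring using (sum-cong-≋)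
  open FiniteSums ringK
  open IntegerCoefficients ringK
  open R using () renaming
    ( solve to solveˢ; _:=_ to _:=ˢ_; _:+_ to _:+ˢ_; _:*_ to _:*ˢ_
    ; _:-_ to _:-ˢ_; :1 to :1ˢ )
  open Exp using () renaming
    ( solve to solveₑ; _:=_ to _:=ₑ_; _:+_ to _:+ₑ_
    ; _:-_ to _:-ₑ_; :0 to :0ₑ; :1 to :1ₑ )
  open SetoidReasoning K.setoid

  -- Apartness of a from 0 provides an inverse of the difference a - 0, which still has to be
  -- simplified to a.
  ⁻¹-inverseˡ : ∀ {a} (a#0 : a # 0#) → a ⁻¹⟨ a#0 ⟩ * a ≈ 1#
  ⁻¹-inverseˡ {a} a#0 = trans (*-congˡ (sym (x-0≈x a))) (proj₁ (proj₂ (#⇒invertible a#0)))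

  *-⁻¹-cancelˡ : ∀ {a} (a#0 : a # 0#) x → a * (a ⁻¹⟨ a#0 ⟩ * x) ≈ x
  *-⁻¹-cancelˡ {a} a#0 x = begin
    a * (a ⁻¹⟨ a#0 ⟩ * x)  ≈⟨ solve 3 (λ a i x → a :* (i :* x) := i :* a :* x) refl a _ x ⟩
    a ⁻¹⟨ a#0 ⟩ * a * x    ≈⟨ *-congʳ (⁻¹-inverseˡ a#0) ⟩
    1# * x                 ≈⟨ *-identityˡ x ⟩
    x                      ∎

  #0-cancelˡ : ∀ {a x y} → a # 0# → a * x ≈ a * y → x ≈ y
  #0-cancelˡ {a} {x} {y} a#0 ax≈ay = begin
    x                      ≈⟨ inverse x ⟨
    a ⁻¹⟨ a#0 ⟩ * (a * x)  ≈⟨ *-congˡ ax≈ay ⟩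
    a ⁻¹⟨ a#0 ⟩ * (a * y)  ≈⟨ inverse y ⟩
    y                      ∎
    where
    inverse : ∀ x → a ⁻¹⟨ a#0 ⟩ * (a * x) ≈ x
    inverse x = trans (sym (*-assoc _ _ _)) (trans (*-congʳ (⁻¹-inverseˡ a#0)) (*-identityˡ x))

  -- The first m terms are restored one at a time by `⟶-untail`. In every infinite sum below, each
  -- coefficient of the partial sums becomes constant, so this settles their convergence.
  ⟶-eventually-const : ∀ m {s a} → (∀ n → m ≤ n → s n ≈ a) → s ⟶ a
  ⟶-eventually-const zero    s≈a = ⟶-cong (λ n → sym (s≈a n z≤n)) refl (⟶-const _)
  ⟶-eventually-const (suc m) s≈a = ⟶-untail (⟶-eventually-const m (λ n m≤n → s≈a (suc n) (s≤s m≤n)))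

  q^ι : ∀ n → q^⟨ ι n ⟩ ≈ q ^ n
  q^ι zero    = q^-zero
  q^ι (suc n) = trans (q^-homo 1ₑ (ι n)) (*-congˡ (q^ι n))

  q^-split : ∀ {a b} c → a ≈ₑ b +ₑ c → q^⟨ a ⟩ ≈ q^⟨ b ⟩ * q^⟨ c ⟩
  q^-split c a≈b+c = trans (q^-cong a≈b+c) (q^-homo _ c)

  ι-∸ : ∀ {j k} → k ≤ j → ι (j ∸ k) ≈ₑ ι j -ₑ ι k
  ι-∸ {j} {zero} z≤n = solveₑ 1 (λ x → x :=ₑ x :-ₑ :0ₑ) Exp.refl (ι j)
  ι-∸ {suc j} {suc k} (s≤s k≤j) = Exp.trans (ι-∸ k≤j)
    (solveₑ 2 (λ x y → x :-ₑ y :=ₑ (:1ₑ :+ₑ x) :-ₑ (:1ₑ :+ₑ y)) Exp.refl (ι j) (ι k))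

  []-cong : ∀ {a b} → a ≈ₑ b → [ a ] ≈ [ b ]
  []-cong a≈b = *-congʳ (+-congˡ (K.-‿cong (q^-cong a≈b)))

  -- Identities with brackets are proved after multiplication by 1 - q, where they become polynomial
  -- in powers of q; the factor is cancelled at the end.
  [1-q]*[_] : ∀ a → (1# - q) * [ a ] ≈ 1# - q^⟨ a ⟩
  [1-q]*[ a ] = trans (*-congˡ (*-comm _ _)) (*-⁻¹-cancelˡ 1-q#0 _)

  qPoch-cong : ∀ {a b} n → a ≈ b → qPoch a n ≈ qPoch b n
  qPoch-cong n a≈b = product-cong n (λ i → +-congˡ (K.-‿cong (*-congʳ {q ^ i} a≈b)))

  qPoch-snoc : ∀ a n → qPoch a (suc n) ≈ qPoch a n * (1# - a * q ^ n)
  qPoch-snoc a n = product-snoc n (λ i → 1# - a * q ^ i)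

  qPoch-cons : ∀ a n → qPoch a (suc n) ≈ (1# - a) * qPoch (a * q) n
  qPoch-cons a n = *-cong (+-congˡ (K.-‿cong (*-identityʳ a)))
    (product-cong n (λ i → +-congˡ (K.-‿cong (sym (*-assoc a q (q ^ i))))))

  choose-cong : ∀ {a b} n → a ≈ₑ b → ⟦ a choose n ⟧ ≈ ⟦ b choose n ⟧
  choose-cong n a≈b = *-congʳ (qPoch-cong n (q^-cong (Exp.+-congʳ (Exp.+-congʳ a≈b))))

  qPoch-*-choose : ∀ a n → qPoch q n * ⟦ a choose n ⟧ ≈ qPoch q^⟨ a -ₑ ι n +ₑ 1ₑ ⟩ n
  qPoch-*-choose a n = trans (*-congˡ (*-comm _ _)) (*-⁻¹-cancelˡ (qPoch#0 n) _)

  -- Dilation by q and first-order q-difference equations.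

  σ : Seriesˣ → Seriesˣ
  σ f n = q ^ n * f n

  -- Substituting q x for x is a ring homomorphism. In the induction, the factor q left over from
  -- the degree shift turns `σ (f ∘ suc)` into `σ f ∘ suc`.
  σ-* : ∀ f g → σ (f *ˣ g) ≈ˣ σ f *ˣ σ g
  σ-* f g zero    = solve 2 (λ x y → :1 :* (x :* y :+ :0) := :1 :* x :* (:1 :* y) :+ :0)
       refl (f 0) (g 0)
  σ-* f g (suc n) = begin
    q ^ suc n * (f 0 * g (suc n) + ((f ∘ suc) *ˣ g) n)
      ≈⟨ solve 5 (λ q Q x y z → q :* Q :* (x :* y :+ z) := :1 :* x :* (q :* Q :* y) :+ q :* (Q :* z))
           refl q (q ^ n) (f 0) (g (suc n)) _ ⟩
    σ f 0 * σ g (suc n) + q * σ ((f ∘ suc) *ˣ g) n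
      ≈⟨ +-congˡ (*-congˡ (σ-* (f ∘ suc) g n)) ⟩
    σ f 0 * σ g (suc n) + q * (σ (f ∘ suc) *ˣ σ g) n
      ≈⟨ +-congˡ (Kˣ.*ˢ-scaleˡ q (σ (f ∘ suc)) (σ g) n) ⟨
    σ f 0 * σ g (suc n) + ((λ k → q * σ (f ∘ suc) k) *ˣ σ g) n
      ≈⟨ +-congˡ (Kˣ.*ˢ-cong {λ k → q * σ (f ∘ suc) k} {σ f ∘ suc} {σ g} 
           (λ k → sym (*-assoc q (q ^ k) _)) R.refl n) ⟩
    (σ f *ˣ σ g) (suc n) ∎

  linear : Carrier → Seriesˣ
  linear a = 1ˣ +ˣ -ˣ (constˣ a *ˣ X)

  linear-*-expand : ∀ a f → linear a *ˣ f ≈ˣ f +ˣ -ˣ (constˣ a *ˣ (X *ˣ f))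
  linear-*-expand a f = solveˢ 3 (λ c x f → (:1ˢ :-ˢ c :*ˢ x) :*ˢ f :=ˢ f :-ˢ c :*ˢ (x :*ˢ f))
    R.refl (constˣ a) X f

  linear-*₀ : ∀ a f → (linear a *ˣ f) 0 ≈ f 0
  linear-*₀ a f = begin
    (linear a *ˣ f) 0                   ≈⟨ linear-*-expand a f 0 ⟩
    f 0 - (constˣ a *ˣ (X *ˣ f)) 0
      ≈⟨ +-congˡ (K.-‿cong (trans (Kˣ.const-* a (X *ˣ f) 0) (*-congˡ (Kˣ.var-*₀ f)))) ⟩
    f 0 - a * 0#                        ≈⟨ solve 2 (λ x a → x :- a :* :0 := x) refl (f 0) a ⟩
    f 0                                 ∎

  linear-*₊ : ∀ a f n → (linear a *ˣ f) (suc n) ≈ f (suc n) - a * f n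
  linear-*₊ a f n = trans (linear-*-expand a f (suc n))
    (+-congˡ (K.-‿cong (trans (Kˣ.const-* a (X *ˣ f) (suc n)) (*-congˡ (Kˣ.var-*₊ f n)))))

  -- f = (bx;q)_∞ / (ax;q)_∞
  record PochRatio (a b : Carrier) (f : Seriesˣ) : Set ℓ₁ where
    field
      constant   : f 0 ≈ 1#
      recurrence : ∀ n → (1# - q ^ suc n) * f (suc n) ≈ (a - b * q ^ n) * f n

    -- In degree n+1 the equation reads f(n+1) - a f(n) = q^(n+1) f(n+1) - b q^n f(n), which is
    -- `recurrence` rearranged. The recurrence suits uniqueness and concrete coefficients, the
    -- functional equation suits products.
    functional-equation : linear a *ˣ f ≈ˣ linear b *ˣ σ f
    functional-equation zero    = begin
      (linear a *ˣ f) 0    ≈⟨ linear-*₀ a f ⟩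
      f 0                  ≈⟨ *-identityˡ _ ⟨
      σ f 0                ≈⟨ linear-*₀ b (σ f) ⟨
      (linear b *ˣ σ f) 0  ∎
    functional-equation (suc n) = begin
      (linear a *ˣ f) (suc n)
        ≈⟨ linear-*₊ a f n ⟩
      f (suc n) - a * f n
        ≈⟨ solve 4 (λ x y Q a → x :- a :* y := (:1 :- Q) :* x :+ (Q :* x :- a :* y))
             refl (f (suc n)) (f n) (q ^ suc n) a ⟩
      (1# - q ^ suc n) * f (suc n) + (q ^ suc n * f (suc n) - a * f n)
        ≈⟨ +-congʳ (recurrence n) ⟩
      (a - b * q ^ n) * f n + (q ^ suc n * f (suc n) - a * f n)
        ≈⟨ solve 5 (λ x y Q a b → (a :- b :* Q) :* y :+ (x :- a :* y) := x :- b :* (Q :* y))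
             refl (σ f (suc n)) (f n) (q ^ n) a b ⟩
      σ f (suc n) - b * σ f n
        ≈⟨ linear-*₊ b (σ f) n ⟨
      (linear b *ˣ σ f) (suc n) ∎

  open PochRatio

  fromFunctionalEquation : ∀ {a b f} → f 0 ≈ 1# → linear a *ˣ f ≈ˣ linear b *ˣ σ f → PochRatio a b f
  fromFunctionalEquation {a} {b} {f} f₀≈1 eq = record
    { constant   = f₀≈1
    ; recurrence = λ n → begin
        (1# - q ^ suc n) * f (suc n)
          ≈⟨ solve 4 (λ x y Q a → (:1 :- Q) :* x := x :- a :* y :- (Q :* x :- a :* y))
               refl (f (suc n)) (f n) (q ^ suc n) a ⟩
        f (suc n) - a * f n - (σ f (suc n) - a * f n)
          ≈⟨ +-congʳ (trans (sym (linear-*₊ a f n)) (trans (eq (suc n)) (linear-*₊ b (σ f) n))) ⟩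
        σ f (suc n) - b * σ f n - (σ f (suc n) - a * f n)
          ≈⟨ solve 5 (λ x y Q a b → x :- b :* (Q :* y) :- (x :- a :* y) := (a :- b :* Q) :* y)
               refl (σ f (suc n)) (f n) (q ^ n) a b ⟩
        (a - b * q ^ n) * f n ∎
    }

  -- Since q is no root of unity, 1 - q^(n+1) can be cancelled, and the recurrence determines each
  -- coefficient from the one before.
  ratio-unique : ∀ {a b f g} → PochRatio a b f → PochRatio a b g → f ≈ˣ g
  ratio-unique F G zero    = trans (constant F) (sym (constant G))
  ratio-unique F G (suc n) = #0-cancelˡ (1-q^n#0 (suc n))
    (trans (recurrence F n) (trans (*-congˡ (ratio-unique F G n)) (sym (recurrence G n))))

  ratio-congᵇ : ∀ {a b b′ f} → b ≈ b′ → PochRatio a b f → PochRatio a b′ f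
  ratio-congᵇ b≈b′ F = record
    { constant   = constant F
    ; recurrence = λ n → trans (recurrence F n) (*-congʳ (+-congˡ (K.-‿cong (*-congʳ b≈b′))))
    }

  ratio-1 : ∀ a → PochRatio a a 1ˣ
  ratio-1 a = record
    { constant   = refl
    ; recurrence = λ where
        zero    → solve 2 (λ q a → (:1 :- q) :* :0 := (a :- a :* :1) :* :1) refl (q ^ 1) a
        (suc n) → trans (zeroʳ _) (sym (zeroʳ _))
    }

  -- The infinite product with parameter b cancels. In terms of functional equations, the factor 1 -
  -- b x that f produces is the one that g absorbs.
  ratio-* : ∀ {a b c f g} → PochRatio a b f → PochRatio b c g → PochRatio a c (f *ˣ g)
  ratio-* {a} {b} {c} {f} {g} F G = fromFunctionalEquation
    (trans (+-identityʳ _) (trans (*-cong (constant F) (constant G)) (*-identityˡ 1#)))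
    (R.begin
      linear a *ˣ (f *ˣ g)           R.≈⟨ R.*-assoc (linear a) f g ⟨
      linear a *ˣ f *ˣ g             R.≈⟨ R.*-congʳ {g} (functional-equation F) ⟩
      linear b *ˣ σ f *ˣ g
        R.≈⟨ solveˢ 3 (λ l f g → l :*ˢ f :*ˢ g :=ˢ f :*ˢ (l :*ˢ g)) R.refl (linear b) (σ f) g ⟩
      σ f *ˣ (linear b *ˣ g)         R.≈⟨ R.*-congˡ {σ f} (functional-equation G) ⟩
      σ f *ˣ (linear c *ˣ σ g)
        R.≈⟨ solveˢ 3 (λ l f g → f :*ˢ (l :*ˢ g) :=ˢ l :*ˢ (f :*ˢ g))
             R.refl (linear c) (σ f) (σ g) ⟩
      linear c *ˣ (σ f *ˣ σ g)       R.≈⟨ R.*-congˡ {linear c} (σ-* f g) ⟨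
      linear c *ˣ σ (f *ˣ g)         R.∎)

  ratio-σ : ∀ {a b f} → PochRatio a b f → PochRatio (q * a) (q * b) (σ f)
  ratio-σ {a} {b} {f} F = record
    { constant   = trans (*-identityˡ _) (constant F)
    ; recurrence = λ n → begin
        (1# - q ^ suc n) * (q ^ suc n * f (suc n))
          ≈⟨ solve 3 (λ x y z → x :* (y :* z) := y :* (x :* z)) refl _ _ _ ⟩
        q ^ suc n * ((1# - q ^ suc n) * f (suc n))
          ≈⟨ *-congˡ (recurrence F n) ⟩
        q ^ suc n * ((a - b * q ^ n) * f n)
          ≈⟨ solve 5 (λ q Q a b x → q :* Q :* ((a :- b :* Q) :* x) := (q :* a :- q :* b :* Q) :* (Q :* x))
               refl q (q ^ n) a b (f n) ⟩
        (q * a - q * b * q ^ n) * σ f n ∎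
    }

  -- 1 - a x is the first factor of (a x;q)_∞, and the remaining factors form (q a x;q)_∞.
  ratio-linear : ∀ a → PochRatio (q * a) a (linear a)
  ratio-linear a = record
    { constant   = l₀
    ; recurrence = λ where
        zero          → begin
          (1# - q ^ 1) * linear a 1   ≈⟨ *-congˡ l₁ ⟩
          (1# - q ^ 1) * - a
            ≈⟨ solve 2 (λ q a → (:1 :- q :* :1) :* (:- a) := (q :* a :- a :* :1) :* :1) refl q a ⟩
          (q * a - a * 1#) * 1#       ≈⟨ *-congˡ l₀ ⟨
          (q * a - a * 1#) * linear a 0 ∎
        -- Here the multiplier q a - a q is zero, which is why the series stops after degree 1.
        (suc zero)    → begin
          (1# - q ^ 2) * linear a 2   ≈⟨ *-congˡ (l₂ 0) ⟩
          (1# - q ^ 2) * 0#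
            ≈⟨ solve 2 (λ q a → (:1 :- q :* (q :* :1)) :* :0 := (q :* a :- a :* (q :* :1)) :* (:- a))
                 refl q a ⟩
          (q * a - a * q ^ 1) * - a   ≈⟨ *-congˡ l₁ ⟨
          (q * a - a * q ^ 1) * linear a 1 ∎
        (suc (suc n)) → trans (*-congˡ (l₂ (suc n)))
          (trans (zeroʳ _) (sym (trans (*-congˡ (l₂ n)) (zeroʳ _))))
    }
    where
    coeff : linear a ≈ˣ linear a *ˣ 1ˣ
    coeff = R.sym (R.*-identityʳ (linear a))
    l₀ : linear a 0 ≈ 1#
    l₀ = trans (coeff 0) (linear-*₀ a 1ˣ)
    l₁ : linear a 1 ≈ - a
    l₁ = trans (coeff 1) (trans (linear-*₊ a 1ˣ 0) (solve 1 (λ a → :0 :- a :* :1 := :- a) refl a))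
    l₂ : ∀ n → linear a (2 ℕ.+ n) ≈ 0#
    l₂ n = trans (coeff (2 ℕ.+ n))
      (trans (linear-*₊ a 1ˣ (suc n)) (solve 1 (λ a → :0 :- a :* :0 := :0) refl a))

  -- Parameter 0 makes the denominator 1. The coefficients of `qPochˣ∞` were defined by solving this
  -- very recurrence for the next coefficient.
  ratio-qPoch∞ : ∀ a → PochRatio 0# a (qPochˣ∞ a)
  ratio-qPoch∞ a = record
    { constant   = refl
    ; recurrence = λ n → trans (*-⁻¹-cancelˡ (1-q^n#0 (suc n)) _)
        (solve 3 (λ a Q x → (:- a) :* ((Q :- :0) :* x) := (:0 :- a :* Q) :* x)
             refl a (q ^ n) (qPochˣ∞ a n))
    }

  -- q-binomial expansions of (x;q)_N and of its reciprocal.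

  multichoose : Exponent → Seriesˣ
  multichoose N j = ⟦ ι j +ₑ N -ₑ 1ₑ choose j ⟧

  -- The q-binomial theorem for 1/(x;q)_N = (q^N x;q)_∞ / (x;q)_∞. Multiplied by (q;q)_n, the n-th
  -- coefficient is (q^N;q)_n, whose successive quotients are the factors 1 - q^(N+n).
  ratio-multichoose : ∀ N → PochRatio 1# q^⟨ N ⟩ (multichoose N)
  ratio-multichoose N = record
    { constant   = trans (sym (*-identityˡ _)) (numerator 0)
    ; recurrence = λ n → #0-cancelˡ (qPoch#0 n) (begin
        qPoch q n * ((1# - q ^ suc n) * multichoose N (suc n))
          ≈⟨ *-assoc _ _ _ ⟨
        qPoch q n * (1# - q ^ suc n) * multichoose N (suc n)
          ≈⟨ *-congʳ (qPoch-snoc q n) ⟨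
        qPoch q (suc n) * multichoose N (suc n)
          ≈⟨ numerator (suc n) ⟩
        qPoch q^⟨ N ⟩ (suc n)
          ≈⟨ qPoch-snoc q^⟨ N ⟩ n ⟩
        qPoch q^⟨ N ⟩ n * (1# - q^⟨ N ⟩ * q ^ n)
          ≈⟨ *-congʳ (numerator n) ⟨
        qPoch q n * multichoose N n * (1# - q^⟨ N ⟩ * q ^ n)
          ≈⟨ solve 3 (λ x y z → x :* y :* z := x :* (z :* y)) refl _ _ _ ⟩
        qPoch q n * ((1# - q^⟨ N ⟩ * q ^ n) * multichoose N n) ∎)
    }
    where
    numerator : ∀ n → qPoch q n * multichoose N n ≈ qPoch q^⟨ N ⟩ n
    numerator n = trans (qPoch-*-choose _ n) (qPoch-cong n (q^-cong
      (solveₑ 2 (λ i N → i :+ₑ N :-ₑ :1ₑ :-ₑ i :+ₑ :1ₑ :=ₑ N) Exp.refl (ι n) N)))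

  gauss : Exponent → Seriesˣ
  gauss N j = ⟦ N choose j ⟧ * (- 1#) ^ j * q ^ (j C 2)

  -- Gauss's expansion of (x;q)_N = (x;q)_∞ / (q^N x;q)_∞. The recurrence combines `choose-suc` with
  -- the increment n of the binomial exponent.
  ratio-gauss : ∀ N → PochRatio q^⟨ N ⟩ 1# (gauss N)
  ratio-gauss N = record
    { constant   = begin
        ⟦ N choose 0 ⟧ * 1# * 1#  ≈⟨ trans (*-identityʳ _) (*-identityʳ _) ⟩
        ⟦ N choose 0 ⟧            ≈⟨ *-identityˡ _ ⟨
        qPoch q 0 * ⟦ N choose 0 ⟧ ≈⟨ qPoch-*-choose N 0 ⟩
        1# ∎
    ; recurrence = λ n → begin
        (1# - q ^ suc n) * (⟦ N choose suc n ⟧ * (- 1#) ^ suc n * q ^ (suc n C 2))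
          ≈⟨ solve 4 (λ a b c d → a :* (b :* c :* d) := a :* b :* (c :* d)) refl _ _ _ _ ⟩
        (1# - q ^ suc n) * ⟦ N choose suc n ⟧ * ((- 1#) ^ suc n * q ^ (suc n C 2))
          ≈⟨ *-cong (choose-suc n) (*-congˡ (q^C2 n)) ⟩
        (1# - q^⟨ N -ₑ ι n ⟩) * ⟦ N choose n ⟧ * ((- 1#) ^ suc n * (q ^ n * q ^ (n C 2)))
          ≈⟨ solve 5 (λ w b s Q T → (:1 :- w) :* b :* ((:- :1) :* s :* (Q :* T))
                                := (w :* Q :- :1 :* Q) :* (b :* s :* T))
               refl q^⟨ N -ₑ ι n ⟩ ⟦ N choose n ⟧ ((- 1#) ^ n) (q ^ n) (q ^ (n C 2)) ⟩
        (q^⟨ N -ₑ ι n ⟩ * q ^ n - 1# * q ^ n) * gauss N n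
          ≈⟨ *-congʳ (+-congʳ (trans (*-congˡ (sym (q^ι n))) (sym (q^-split (ι n)
               (solveₑ 2 (λ N i → N :=ₑ N :-ₑ i :+ₑ i) Exp.refl N (ι n)))))) ⟩
        (q^⟨ N ⟩ - 1# * q ^ n) * gauss N n ∎
    }
    where
    q^C2 : ∀ n → q ^ (suc n C 2) ≈ q ^ n * q ^ (n C 2)
    q^C2 n = trans (reflexive (≡.cong (q ^_)
        (≡.trans (≡.sym (nCk+nC[k+1]≡[n+1]C[k+1] n 1)) (≡.cong (ℕ._+ n C 2) (nC1≡n n)))))
      (^-homo-* q n (n C 2))
    -- Passing from n to n+1 adds a factor at the front of the numerator but at the end of the
    -- denominator, hence `qPoch-cons` for one and `qPoch-snoc` for the other.
    choose-suc : ∀ n → (1# - q ^ suc n) * ⟦ N choose suc n ⟧ ≈ (1# - q^⟨ N -ₑ ι n ⟩) * ⟦ N choose n ⟧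
    choose-suc n = #0-cancelˡ (qPoch#0 n) (begin
      qPoch q n * ((1# - q ^ suc n) * ⟦ N choose suc n ⟧)
        ≈⟨ *-assoc _ _ _ ⟨
      qPoch q n * (1# - q ^ suc n) * ⟦ N choose suc n ⟧
        ≈⟨ *-congʳ (qPoch-snoc q n) ⟨
      qPoch q (suc n) * ⟦ N choose suc n ⟧
        ≈⟨ qPoch-*-choose N (suc n) ⟩
      qPoch q^⟨ N -ₑ ι (suc n) +ₑ 1ₑ ⟩ (suc n)
        ≈⟨ qPoch-cong (suc n) (q^-cong (solveₑ 2 (λ N i → N :-ₑ (:1ₑ :+ₑ i) :+ₑ :1ₑ :=ₑ N :-ₑ i)
             Exp.refl N (ι n))) ⟩
      qPoch q^⟨ N -ₑ ι n ⟩ (suc n)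
        ≈⟨ qPoch-cons q^⟨ N -ₑ ι n ⟩ n ⟩
      (1# - q^⟨ N -ₑ ι n ⟩) * qPoch (q^⟨ N -ₑ ι n ⟩ * q) n
        ≈⟨ *-congˡ (qPoch-cong n (q^-homo (N -ₑ ι n) 1ₑ)) ⟨
      (1# - q^⟨ N -ₑ ι n ⟩) * qPoch q^⟨ N -ₑ ι n +ₑ 1ₑ ⟩ n
        ≈⟨ *-congˡ (qPoch-*-choose N n) ⟨
      (1# - q^⟨ N -ₑ ι n ⟩) * (qPoch q n * ⟦ N choose n ⟧)
        ≈⟨ solve 3 (λ x y z → x :* (y :* z) := y :* (x :* z)) refl _ _ _ ⟩
      qPoch q n * ((1# - q^⟨ N -ₑ ι n ⟩) * ⟦ N choose n ⟧) ∎)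

  -- The two factors have opposite parameter pairs, so the product has two equal parameters, like
  -- the series 1.
  gauss-*-multichoose : ∀ N → gauss N *ˣ multichoose N ≈ˣ 1ˣ
  gauss-*-multichoose N =
    ratio-unique (ratio-* (ratio-gauss N) (ratio-multichoose N)) (ratio-1 q^⟨ N ⟩)

  -- Both (x;q)_∞ and (q^N x;q)_∞ times `gauss N` have parameters 0 and 1, so they agree; dividing
  -- by (q^N x;q)_∞ gives the claim.
  qPochʳ≈gauss : ∀ N → qPochʳ N ≈ˣ gauss N
  qPochʳ≈gauss N = R.begin
    P 1# *ˣ recipˣ (P z)              R.≈⟨ R.*-congʳ {recipˣ (P z)}
      (ratio-unique (ratio-qPoch∞ 1#) (ratio-* (ratio-qPoch∞ z) (ratio-gauss N))) ⟩
    P z *ˣ gauss N *ˣ recipˣ (P z)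
      R.≈⟨ solveˢ 3 (λ p g r → p :*ˢ g :*ˢ r :=ˢ g :*ˢ (p :*ˢ r))
           R.refl (P z) (gauss N) (recipˣ (P z)) ⟩
    gauss N *ˣ (P z *ˣ recipˣ (P z))  R.≈⟨ R.*-congˡ {gauss N} (Kˣ.recip-inverse (P z) refl) ⟩
    gauss N *ˣ 1ˣ                     R.≈⟨ R.*-identityʳ (gauss N) ⟩
    gauss N                           R.∎
    where
    P = qPochˣ∞
    z = q^⟨ N ⟩

  recip-qPochʳ : ∀ N → recipˣ (qPochʳ N) ≈ˣ multichoose N
  recip-qPochʳ N = Kˣ.recip-unique (qPochʳ N) (multichoose N)
    (trans (qPochʳ≈gauss N 0) (constant (ratio-gauss N)))
    (R.trans (R.*-congʳ {multichoose N} (qPochʳ≈gauss N)) (gauss-*-multichoose N))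

  -- Undoes both divisions in `δ`; taking 1 - q in place of q - 1 reverses the order of the
  -- difference.
  X-*-δ : ∀ p k → (1# - q) * (X *ˣ δ p) k ≈ p k - σ p k
  X-*-δ p zero    = begin
    (1# - q) * (X *ˣ δ p) 0  ≈⟨ *-congˡ (Kˣ.var-*₀ (δ p)) ⟩
    (1# - q) * 0#            ≈⟨ solve 2 (λ q x → (:1 :- q) :* :0 := x :- :1 :* x) refl q (p 0) ⟩
    p 0 - 1# * p 0           ∎
  X-*-δ p (suc k) = begin
    (1# - q) * (X *ˣ δ p) (suc k)
      ≈⟨ *-congˡ (Kˣ.var-*₊ (δ p) k) ⟩
    (1# - q) * ((σ p (suc k) - p (suc k)) * (q - 1#) ⁻¹⟨ q-1#0 ⟩)
      ≈⟨ solve 4 (λ q s x i → (:1 :- q) :* ((s :- x) :* i) := (q :- :1) :* (i :* (x :- s)))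
           refl q (σ p (suc k)) (p (suc k)) _ ⟩
    (q - 1#) * ((q - 1#) ⁻¹⟨ q-1#0 ⟩ * (p (suc k) - σ p (suc k)))
      ≈⟨ *-⁻¹-cancelˡ q-1#0 _ ⟩
    p (suc k) - σ p (suc k) ∎

  -- The q-difference equation of the q-Eulerian polynomials.

  module _ (α β : Exponent) where

    E-vanishes : ∀ n k → n < k → E α β n k ≈ 0#
    E-vanishes zero    (suc k) _         = refl
    E-vanishes (suc n) (suc k) (s<s n<k) = trans
      (+-cong (trans (*-congˡ (E-vanishes n k n<k)) (zeroʳ _))
              (trans (*-congˡ (E-vanishes n (suc k) (ℕ.m<n⇒m<1+n n<k))) (zeroʳ _)))
      (+-identityˡ 0#)

    -- Allows the row `E α β n` to serve directly as a power series. Above degree n no term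
    -- contributes, in accordance with `E-vanishes`.
    Eₓ≈E : ∀ n → Eₓ α β n ≈ˣ E α β n
    Eₓ≈E n k = trans (Kˣ.sumˢ-coeff (suc n) (term ∘ toℕ) k) (sum-term (n ℕ.<? k))
      where
      term : ℕ → Seriesˣ
      term j = constˣ (E α β n j) *ˣ X ^ˣ j

      term-same : term k k ≈ E α β n k
      term-same = trans (R.*-comm (constˣ (E α β n k)) (X ^ˣ k) k) (Kˣ.monomial-same k _)

      term-other : ∀ j → j ≢ k → term j k ≈ 0#
      term-other j j≢k = trans (R.*-comm (constˣ (E α β n j)) (X ^ˣ j) k) (Kˣ.monomial-other j _ k j≢k)

      sum-term : Dec (n < k) → sum {suc n} (λ i → term (toℕ i) k) ≈ E α β n k
      sum-term (no n≮k)  = trans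
        (sum-single (suc n) (λ j → term j k) k (s≤s (ℕ.≮⇒≥ n≮k)) term-other) term-same
      sum-term (yes n<k) = trans
        (sum-zero (suc n) (λ i → term (toℕ i) k)
          (λ i → term-other (toℕ i) (ℕ.<⇒≢ (ℕ.≤-<-trans (toℕ≤pred[n] i) n<k))))
        (sym (E-vanishes n k n<k))

    b : Carrier
    b = q^⟨ β ⟩

    exponent : ℕ → Exponent
    exponent n = ι n +ₑ α +ₑ β

    z : ℕ → Carrier
    z n = q^⟨ exponent n ⟩

    z-suc : ∀ n → z (suc n) ≈ q * z n
    z-suc n = trans (q^-cong (solveₑ 3 (λ i a b → :1ₑ :+ₑ i :+ₑ a :+ₑ b :=ₑ :1ₑ :+ₑ (i :+ₑ a :+ₑ b))
         Exp.refl (ι n) α β))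
      (q^-homo 1ₑ (exponent n))

    [1-q]*[ι+β] : ∀ k → (1# - q) * [ ι k +ₑ β ] ≈ 1# - b * q ^ k
    [1-q]*[ι+β] k = trans [1-q]*[ ι k +ₑ β ]
      (+-congˡ (K.-‿cong (trans (q^-split (ι k) (Exp.+-comm (ι k) β)) (*-congˡ (q^ι k)))))

    -- Multiplication by 1 - q turns the brackets into differences of powers of q. The product of
    -- q^(β+k) and q^(n-k+α) is `z n` for every k, so those terms add up to multiplication by `z n`
    -- x; the powers q^k that remain are absorbed by `σ`.
    E-qDifference : ∀ n → constˣ (1# - q) *ˣ E α β (suc n) ≈ˣ
                     linear (z n) *ˣ E α β n +ˣ -ˣ (constˣ b *ˣ (linear 1# *ˣ σ (E α β n)))
    E-qDifference n zero    = begin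
      (constˣ (1# - q) *ˣ E α β (suc n)) 0
        ≈⟨ Kˣ.const-* (1# - q) (E α β (suc n)) 0 ⟩
      (1# - q) * ([ ι 0 +ₑ β ] * e₀)
        ≈⟨ trans (sym (*-assoc _ _ _)) (*-congʳ ([1-q]*[ι+β] 0)) ⟩
      (1# - b * 1#) * e₀
        ≈⟨ solve 2 (λ b e → (:1 :- b :* :1) :* e := e :- b :* (:1 :* e)) refl b e₀ ⟩
      e₀ - b * σ (E α β n) 0
        ≈⟨ +-cong (linear-*₀ (z n) (E α β n))
                  (K.-‿cong (trans (Kˣ.const-* b (linear 1# *ˣ σ (E α β n)) 0)
                                  (*-congˡ (linear-*₀ 1# (σ (E α β n)))))) ⟨
      (linear (z n) *ˣ E α β n) 0 - (constˣ b *ˣ (linear 1# *ˣ σ (E α β n))) 0 ∎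
      where e₀ = E α β n 0
    E-qDifference n (suc k) = begin
      (constˣ (1# - q) *ˣ E α β (suc n)) (suc k)
        ≈⟨ Kˣ.const-* (1# - q) (E α β (suc n)) (suc k) ⟩
      (1# - q) * (q^⟨ β +ₑ ι (suc k) -ₑ 1ₑ ⟩ * [ a ] * e₀ + [ ι (suc k) +ₑ β ] * e₁)
        ≈⟨ *-congˡ (+-congʳ (*-congʳ (*-congʳ q^[β+k]))) ⟩
      (1# - q) * (b * q ^ k * [ a ] * e₀ + [ ι (suc k) +ₑ β ] * e₁)
        ≈⟨ solve 7 (λ q b Q x y e f → (:1 :- q) :* (b :* Q :* x :* e :+ y :* f)
                                    := b :* Q :* ((:1 :- q) :* x) :* e :+ (:1 :- q) :* y :* f)
             refl q b (q ^ k) [ a ] [ ι (suc k) +ₑ β ] e₀ e₁ ⟩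
      b * q ^ k * ((1# - q) * [ a ]) * e₀ + (1# - q) * [ ι (suc k) +ₑ β ] * e₁
        ≈⟨ +-cong (*-congʳ (*-congˡ [1-q]*[ a ])) (*-congʳ ([1-q]*[ι+β] (suc k))) ⟩
      b * q ^ k * (1# - q^⟨ a ⟩) * e₀ + (1# - b * q ^ suc k) * e₁
        ≈⟨ solve 6 (λ q b Q w e f → b :* Q :* (:1 :- w) :* e :+ (:1 :- b :* (q :* Q)) :* f
                                  := f :- b :* Q :* w :* e :- b :* (q :* Q :* f :- :1 :* (Q :* e)))
             refl q b (q ^ k) q^⟨ a ⟩ e₀ e₁ ⟩
      e₁ - b * q ^ k * q^⟨ a ⟩ * e₀ - b * (σ (E α β n) (suc k) - 1# * σ (E α β n) k)
        ≈⟨ +-congʳ (+-congˡ (K.-‿cong (*-congʳ bqᵏqᵃ≈z))) ⟩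
      e₁ - z n * e₀ - b * (σ (E α β n) (suc k) - 1# * σ (E α β n) k)
        ≈⟨ +-cong (linear-*₊ (z n) (E α β n) k)
                  (K.-‿cong (trans (Kˣ.const-* b (linear 1# *ˣ σ (E α β n)) (suc k))
                                  (*-congˡ (linear-*₊ 1# (σ (E α β n)) k)))) ⟨
      (linear (z n) *ˣ E α β n) (suc k) - (constˣ b *ˣ (linear 1# *ˣ σ (E α β n))) (suc k) ∎
      where
      e₀ e₁ : Carrier
      e₀ = E α β n k
      e₁ = E α β n (suc k)
      a : Exponent
      a = ι (suc n) -ₑ ι (suc k) +ₑ α
      q^[β+k] : q^⟨ β +ₑ ι (suc k) -ₑ 1ₑ ⟩ ≈ b * q ^ k
      q^[β+k] = trans (q^-split (ι k) (solveₑ 2 (λ b k → b :+ₑ (:1ₑ :+ₑ k) :-ₑ :1ₑ :=ₑ b :+ₑ k)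
           Exp.refl β (ι k))) (*-congˡ (q^ι k))
      bqᵏqᵃ≈z : b * q ^ k * q^⟨ a ⟩ ≈ z n
      bqᵏqᵃ≈z = sym (trans
        (q^-split a (solveₑ 4 (λ n k a b → n :+ₑ a :+ₑ b :=ₑ
           b :+ₑ k :+ₑ (:1ₑ :+ₑ n :-ₑ (:1ₑ :+ₑ k) :+ₑ a)) Exp.refl (ι n) (ι k) α β))
        (*-congʳ (trans (q^-homo β (ι k)) (*-congˡ (q^ι k)))))

    -- Quotients of the q-Eulerian polynomials by (x;q)_(n+α+β).

    κ : ℕ → Carrier
    κ j = ⟦ ι j +ₑ α +ₑ β -ₑ 1ₑ choose j ⟧

    -- Division by (x;q)_(n+α+β) is expressed through the known coefficients of the reciprocal;
    -- `quotient-coeff` returns to the literal quotient.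
    F : ℕ → Seriesˣ
    F n = E α β n *ˣ multichoose (exponent n)

    -- With N = n+α+β, the last factor of (x;q)_(N+1) is 1 - q^N x; cancelling it leaves 1/(x;q)_N.
    linear-*-multichoose : ∀ n →
      linear (z n) *ˣ multichoose (exponent (suc n)) ≈ˣ multichoose (exponent n)
    linear-*-multichoose n = R.trans (R.*-comm (linear (z n)) (multichoose (exponent (suc n))))
      (ratio-unique (ratio-* (ratio-congᵇ (z-suc n) (ratio-multichoose (exponent (suc n))))
                             (ratio-linear (z n)))
                    (ratio-multichoose (exponent n)))

    -- The first factor of (x;q)_(N+1) is 1 - x; cancelling it leaves 1/(q x;q)_N, the dilation of
    -- 1/(x;q)_N.
    σ-multichoose : ∀ n → σ (multichoose (exponent n)) ≈ˣ linear 1# *ˣ multichoose (exponent (suc n))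
    σ-multichoose n = ratio-unique (ratio-σ (ratio-multichoose (exponent n)))
      (ratio-* (ratio-linear 1#) (ratio-congᵇ (z-suc n) (ratio-multichoose (exponent (suc n)))))

    F-qDifference : ∀ n → constˣ (1# - q) *ˣ F (suc n) ≈ˣ F n +ˣ -ˣ (constˣ b *ˣ σ (F n))
    F-qDifference n = R.begin
      constˣ (1# - q) *ˣ (E α β (suc n) *ˣ B′)
        R.≈⟨ R.*-assoc (constˣ (1# - q)) (E α β (suc n)) B′ ⟨
      constˣ (1# - q) *ˣ E α β (suc n) *ˣ B′
        R.≈⟨ R.*-congʳ {B′} (E-qDifference n) ⟩
      (linear (z n) *ˣ E α β n +ˣ -ˣ (constˣ b *ˣ (linear 1# *ˣ σ (E α β n)))) *ˣ B′
        -- Each linear factor is moved next to `B′`, where one cancels the last and the other the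
        -- first factor of the denominator, leaving `B` and `σ B`.
        R.≈⟨ solveˢ 6 (λ l e b m s B → (l :*ˢ e :-ˢ b :*ˢ (m :*ˢ s)) :*ˢ B
                                    :=ˢ e :*ˢ (l :*ˢ B) :-ˢ b :*ˢ (s :*ˢ (m :*ˢ B)))
               R.refl (linear (z n)) (E α β n) (constˣ b) (linear 1#) (σ (E α β n)) B′ ⟩
      E α β n *ˣ (linear (z n) *ˣ B′) +ˣ -ˣ (constˣ b *ˣ (σ (E α β n) *ˣ (linear 1# *ˣ B′)))
        R.≈⟨ R.+-cong (R.*-congˡ {E α β n} (linear-*-multichoose n))
               (R.-‿cong (R.*-congˡ {constˣ b} (R.*-congˡ {σ (E α β n)} (R.sym (σ-multichoose n))))) ⟩
      F n +ˣ -ˣ (constˣ b *ˣ (σ (E α β n) *ˣ σ B))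
        R.≈⟨ R.+-congˡ {F n} (R.-‿cong (R.*-congˡ {constˣ b} (σ-* (E α β n) B))) ⟨
      F n +ˣ -ˣ (constˣ b *ˣ σ (F n)) R.∎
      where
      B B′ : Seriesˣ
      B  = multichoose (exponent n)
      B′ = multichoose (exponent (suc n))

    -- `σ` acts on x^j as the scalar q^j, so `F-qDifference` is a separate recursion in n for each
    -- j, started by E_0 = 1. Parts (ii) to (v) all rest on this formula.
    F-coeff : ∀ n j → F n j ≈ κ j * [ ι j +ₑ β ] ^ n
    F-coeff zero    j = begin
      F 0 j                        ≈⟨ R.*-congʳ {multichoose (exponent 0)} {E α β 0} {1ˣ} E₀≈1 j ⟩
      (1ˣ *ˣ multichoose (exponent 0)) j ≈⟨ R.*-identityˡ (multichoose (exponent 0)) j ⟩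
      multichoose (exponent 0) j
        ≈⟨ choose-cong j (solveₑ 3 (λ i a b → i :+ₑ (:0ₑ :+ₑ a :+ₑ b) :-ₑ :1ₑ :=ₑ i :+ₑ a :+ₑ b :-ₑ :1ₑ)
             Exp.refl (ι j) α β) ⟩
      κ j ≈⟨ *-identityʳ _ ⟨
      κ j * 1# ∎
      where
      E₀≈1 : E α β 0 ≈ˣ 1ˣ
      E₀≈1 zero    = refl
      E₀≈1 (suc k) = refl
    F-coeff (suc n) j = #0-cancelˡ 1-q#0 (begin
      (1# - q) * F (suc n) j
        ≈⟨ Kˣ.const-* (1# - q) (F (suc n)) j ⟨
      (constˣ (1# - q) *ˣ F (suc n)) j
        ≈⟨ F-qDifference n j ⟩
      F n j - (constˣ b *ˣ σ (F n)) j
        ≈⟨ +-congˡ (K.-‿cong (Kˣ.const-* b (σ (F n)) j)) ⟩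
      F n j - b * (q ^ j * F n j)
        ≈⟨ solve 3 (λ f b Q → f :- b :* (Q :* f) := (:1 :- b :* Q) :* f) refl (F n j) b (q ^ j) ⟩
      (1# - b * q ^ j) * F n j
        ≈⟨ *-cong (sym ([1-q]*[ι+β] j)) (F-coeff n j) ⟩
      (1# - q) * [ ι j +ₑ β ] * (κ j * [ ι j +ₑ β ] ^ n)
        ≈⟨ solve 4 (λ q x c y → (:1 :- q) :* x :* (c :* y) := (:1 :- q) :* (c :* (x :* y)))
             refl q _ _ _ ⟩
      (1# - q) * (κ j * [ ι j +ₑ β ] ^ suc n) ∎)

    quotient-coeff : ∀ n j → (Eₓ α β n *ˣ recipˣ (qPochʳ (exponent n))) j ≈
                     κ j * [ ι j +ₑ β ] ^ n
    quotient-coeff n j = trans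
      (R.*-cong {Eₓ α β n} {E α β n} {recipˣ (qPochʳ (exponent n))} {multichoose (exponent n)}
         (Eₓ≈E n) (recip-qPochʳ (exponent n)) j)
      (F-coeff n j)

    -- The recursion with the q-derivative.

    recursion : ∀ n →
      Eₓ α β (suc n) ≈ˣ
        (constˣ [ β ] +ˣ constˣ (q^⟨ β ⟩ * [ ι (suc n) -ₑ 1ₑ +ₑ α ]) *ˣ X) *ˣ Eₓ α β n
        +ˣ (1ˣ +ˣ -ˣ X) *ˣ X *ˣ constˣ q^⟨ β ⟩ *ˣ δ (Eₓ α β n)
    recursion n = cancel (R.begin
      constˣ (1# - q) *ˣ Eₓ α β (suc n)
        R.≈⟨ R.*-congˡ {constˣ (1# - q)} (Eₓ≈E (suc n)) ⟩
      constˣ (1# - q) *ˣ E α β (suc n)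
        R.≈⟨ E-qDifference n ⟩
      linear (z n) *ˣ E α β n +ˣ -ˣ (constˣ b *ˣ (linear 1# *ˣ σ (E α β n)))
        R.≈⟨ R.+-cong (R.*-congˡ {linear (z n)} (R.sym (Eₓ≈E n)))
               (R.-‿cong (R.*-congˡ {constˣ b} (R.*-congˡ {linear 1#} σE≈σp))) ⟩
      linear (z n) *ˣ p +ˣ -ˣ (constˣ b *ˣ (linear 1# *ˣ σ p))
        -- Writing σ p as p - (p - σ p) isolates the difference that makes up the q-derivative. Then
        -- 1 - b, b - z and p - σ p each contain a factor 1 - q.
        R.≈⟨ solveˢ 5 (λ z x p b σp → (:1ˢ :-ˢ z :*ˢ x) :*ˢ p :-ˢ b :*ˢ ((:1ˢ :-ˢ :1ˢ :*ˢ x) :*ˢ σp)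
                  :=ˢ ((:1ˢ :-ˢ b) :+ˢ (b :-ˢ z) :*ˢ x) :*ˢ p
                         :+ˢ (:1ˢ :-ˢ x) :*ˢ b :*ˢ (p :-ˢ σp))
               R.refl (constˣ (z n)) X p (constˣ b) (σ p) ⟩
      ((1ˣ +ˣ -ˣ constˣ b) +ˣ (constˣ b +ˣ -ˣ constˣ (z n)) *ˣ X) *ˣ p
        +ˣ (1ˣ +ˣ -ˣ X) *ˣ constˣ b *ˣ (p +ˣ -ˣ σ p)
        R.≈⟨ R.+-cong (R.*-congʳ {p} (R.+-cong 1-b≈ (R.*-congʳ {X} b-z≈)))
                      (R.*-congˡ {(1ˣ +ˣ -ˣ X) *ˣ constˣ b} p-σp≈) ⟩
      (constˣ (1# - q) *ˣ constˣ [ β ] +ˣ constˣ (1# - q) *ˣ constˣ s *ˣ X) *ˣ p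
        +ˣ (1ˣ +ˣ -ˣ X) *ˣ constˣ b *ˣ (constˣ (1# - q) *ˣ (X *ˣ δ p))
        R.≈⟨ solveˢ 7 (λ q B c x p b d → (q :*ˢ B :+ˢ q :*ˢ c :*ˢ x) :*ˢ p
                                       :+ˢ (:1ˢ :-ˢ x) :*ˢ b :*ˢ (q :*ˢ (x :*ˢ d))
                :=ˢ q :*ˢ ((B :+ˢ c :*ˢ x) :*ˢ p :+ˢ (:1ˢ :-ˢ x) :*ˢ x :*ˢ b :*ˢ d))
              R.refl (constˣ (1# - q)) (constˣ [ β ]) (constˣ s) X p (constˣ b) (δ p) ⟩
      constˣ (1# - q) *ˣ ((constˣ [ β ] +ˣ constˣ s *ˣ X) *ˣ p
        +ˣ (1ˣ +ˣ -ˣ X) *ˣ X *ˣ constˣ b *ˣ δ p) R.∎)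
      where
      p : Seriesˣ
      p = Eₓ α β n
      s : Carrier
      s = b * [ ι (suc n) -ₑ 1ₑ +ₑ α ]

      cancel : ∀ {f g} → constˣ (1# - q) *ˣ f ≈ˣ constˣ (1# - q) *ˣ g → f ≈ˣ g
      cancel {f} {g} eq k = #0-cancelˡ 1-q#0
        (trans (sym (Kˣ.const-* (1# - q) f k)) (trans (eq k) (Kˣ.const-* (1# - q) g k)))

      σE≈σp : σ (E α β n) ≈ˣ σ p
      σE≈σp k = *-congˡ (sym (Eₓ≈E n k))

      p-σp≈ : p +ˣ -ˣ σ p ≈ˣ constˣ (1# - q) *ˣ (X *ˣ δ p)
      p-σp≈ k = trans (sym (X-*-δ p k)) (sym (Kˣ.const-* (1# - q) (X *ˣ δ p) k))

      1-b≈ : 1ˣ +ˣ -ˣ constˣ b ≈ˣ constˣ (1# - q) *ˣ constˣ [ β ]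
      1-b≈ k = trans (Kˣ.const-- 1# b k)
        (trans (Kˣ.const-cong (sym [1-q]*[ β ]) k) (Kˣ.const-*-const (1# - q) [ β ] k))

      b-z≈ : constˣ b +ˣ -ˣ constˣ (z n) ≈ˣ constˣ (1# - q) *ˣ constˣ s
      b-z≈ k = trans (Kˣ.const-- b (z n) k) (trans (Kˣ.const-cong (begin
        b - z n
          ≈⟨ +-congˡ (K.-‿cong (q^-split {b = β} (ι (suc n) -ₑ 1ₑ +ₑ α)
               (solveₑ 3 (λ n a b → n :+ₑ a :+ₑ b :=ₑ b :+ₑ (:1ₑ :+ₑ n :-ₑ :1ₑ :+ₑ a))
                    Exp.refl (ι n) α β))) ⟩
        b - b * q^⟨ ι (suc n) -ₑ 1ₑ +ₑ α ⟩
          ≈⟨ solve 2 (λ b y → b :- b :* y := b :* (:1 :- y)) refl b _ ⟩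
        b * (1# - q^⟨ ι (suc n) -ₑ 1ₑ +ₑ α ⟩)
          ≈⟨ *-congˡ [1-q]*[ ι (suc n) -ₑ 1ₑ +ₑ α ] ⟨
        b * ((1# - q) * [ ι (suc n) -ₑ 1ₑ +ₑ α ])
          ≈⟨ solve 3 (λ b q y → b :* (q :* y) := q :* (b :* y)) refl _ _ _ ⟩
        (1# - q) * s ∎) k) (Kˣ.const-*-const (1# - q) s k))

    -- Expansions in powers of x and the exponential generating function.

    expansion : ∀ n →
      (λ j → X ^ˣ j *ˣ constˣ (⟦ ι j +ₑ α +ₑ β -ₑ 1ₑ choose j ⟧ * [ ι j +ₑ β ] ^ n))
        sumsToˣ (Eₓ α β n *ˣ recipˣ (qPochʳ (ι n +ₑ α +ₑ β)))
    -- The m-th partial sum has the terms j < m, so the coefficient of x^k is final from m = k+1 on.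
    expansion n k = ⟶-eventually-const (suc k) λ m k<m → begin
      sumˣ {m} (u ∘ toℕ) k
        ≈⟨ Kˣ.sumˢ-coeff m (u ∘ toℕ) k ⟩
      sum {m} (λ i → u (toℕ i) k)
        ≈⟨ sum-single m (λ j → u j k) k k<m (λ j j≢k → Kˣ.monomial-other j _ k j≢k) ⟩
      u k k
        ≈⟨ Kˣ.monomial-same k _ ⟩
      κ k * [ ι k +ₑ β ] ^ n
        ≈⟨ quotient-coeff n k ⟨
      (Eₓ α β n *ˣ recipˣ (qPochʳ (ι n +ₑ α +ₑ β))) k ∎
      where
      u : ℕ → Seriesˣ
      u j = X ^ˣ j *ˣ constˣ (⟦ ι j +ₑ α +ₑ β -ₑ 1ₑ choose j ⟧ * [ ι j +ₑ β ] ^ n)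

    -- The common sum of both sides of (iii): the coefficient of t^m x^k, obtained by dividing the
    -- coefficient in (ii) by m!.
    generatingFunction : Seriesˣᵗ
    generatingFunction m k = κ k * ([ ι k +ₑ β ] ^ m * 1/ m !)

    -- The n-th term is concentrated in t-degree n, so stabilisation depends on the power of t
    -- alone.
    expansionˡ : (λ n → constᵗ (Eₓ α β n *ˣ recipˣ (qPochʳ (ι n +ₑ α +ₑ β)))
                *ˣᵗ (T ^ˣᵗ n *ˣᵗ constᵗ (constˣ (1/ n !))))
        sumsToˣᵗ generatingFunction
    expansionˡ m k = ⟶-eventually-const (suc m) λ N m<N → begin
      sumˣᵗ {N} (v ∘ toℕ) m k
        ≈⟨ Kˣᵗ.sumˢ-coeff N (v ∘ toℕ) m k ⟩
      sumˣ {N} (λ i → v (toℕ i) m) k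
        ≈⟨ R.sum-single N (λ j → v j m) m m<N v-other k ⟩
      v m m k
        ≈⟨ Kˣᵗ.const-* (f m) (T ^ˣᵗ m *ˣᵗ constᵗ (constˣ (1/ m !))) m k ⟩
      (f m *ˣ (T ^ˣᵗ m *ˣᵗ constᵗ (constˣ (1/ m !))) m) k
        ≈⟨ R.*-congˡ {f m} (Kˣᵗ.monomial-same m (constˣ (1/ m !))) k ⟩
      (f m *ˣ constˣ (1/ m !)) k
        ≈⟨ R.*-comm (f m) (constˣ (1/ m !)) k ⟩
      (constˣ (1/ m !) *ˣ f m) k
        ≈⟨ Kˣ.const-* (1/ m !) (f m) k ⟩
      1/ m ! * f m k
        ≈⟨ *-congˡ (quotient-coeff m k) ⟩
      1/ m ! * (κ k * [ ι k +ₑ β ] ^ m)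
        ≈⟨ solve 3 (λ x y z → x :* (y :* z) := y :* (z :* x)) refl _ _ _ ⟩
      generatingFunction m k ∎
      where
      f : ℕ → Seriesˣ
      f n = Eₓ α β n *ˣ recipˣ (qPochʳ (ι n +ₑ α +ₑ β))
      v : ℕ → Seriesˣᵗ
      v n = constᵗ (f n) *ˣᵗ (T ^ˣᵗ n *ˣᵗ constᵗ (constˣ (1/ n !)))
      v-other : ∀ j → j ≢ m → v j m ≈ˣ (λ _ → 0#)
      v-other j j≢m = R.begin
        v j m
          R.≈⟨ Kˣᵗ.const-* (f j) (T ^ˣᵗ j *ˣᵗ constᵗ (constˣ (1/ j !))) m ⟩
        f j *ˣ (T ^ˣᵗ j *ˣᵗ constᵗ (constˣ (1/ j !))) m
          R.≈⟨ R.*-congˡ {f j} (Kˣᵗ.monomial-other j (constˣ (1/ j !)) m j≢m) ⟩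
        f j *ˣ (λ _ → 0#)
          R.≈⟨ R.zeroʳ (f j) ⟩
        (λ _ → 0#) R.∎

    -- The j-th term involves every power of t but only x^j, so here stabilisation depends on the
    -- power of x.
    expansionʳ : (λ j → constᵗ (X ^ˣ j *ˣ constˣ ⟦ ι j +ₑ α +ₑ β -ₑ 1ₑ choose j ⟧)
                *ˣᵗ exp⟨ [ ι j +ₑ β ] t⟩)
        sumsToˣᵗ generatingFunction
    expansionʳ m k = ⟶-eventually-const (suc k) λ N k<N → begin
      sumˣᵗ {N} (w ∘ toℕ) m k
        ≈⟨ Kˣᵗ.sumˢ-coeff N (w ∘ toℕ) m k ⟩
      sumˣ {N} (λ i → w (toℕ i) m) k
        ≈⟨ Kˣ.sumˢ-coeff N (λ i → w (toℕ i) m) k ⟩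
      sum {N} (λ i → w (toℕ i) m k)
        ≈⟨ sum-single N (λ j → w j m k) k k<N
             (λ j j≢k → trans (w-coeff j) (trans (*-congˡ (Kˣ.monomial-other j (κ j) k j≢k)) (zeroʳ _))) ⟩
      w k m k
        ≈⟨ w-coeff k ⟩
      a k * (X ^ˣ k *ˣ constˣ (κ k)) k
        ≈⟨ *-congˡ (Kˣ.monomial-same k (κ k)) ⟩
      a k * κ k
        ≈⟨ *-comm _ _ ⟩
      generatingFunction m k ∎
      where
      w : ℕ → Seriesˣᵗ
      w j = constᵗ (X ^ˣ j *ˣ constˣ (κ j)) *ˣᵗ exp⟨ [ ι j +ₑ β ] t⟩
      a : ℕ → Carrier
      a j = [ ι j +ₑ β ] ^ m * 1/ m !
      w-coeff : ∀ j → w j m k ≈ a j * (X ^ˣ j *ˣ constˣ (κ j)) k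
      w-coeff j = trans (Kˣᵗ.const-* (X ^ˣ j *ˣ constˣ (κ j)) exp⟨ [ ι j +ₑ β ] t⟩ m k)
        (trans (R.*-comm (X ^ˣ j *ˣ constˣ (κ j)) (constˣ (a j)) k)
               (Kˣ.const-* (a j) (X ^ˣ j *ˣ constˣ (κ j)) k))

    -- The Worpitzky identity and the explicit formula.

    worpitzky : ∀ n j →
      ∑≤ j (λ k → ⟦ ι j -ₑ ι k +ₑ ι n +ₑ α +ₑ β -ₑ 1ₑ choose j ∸ k ⟧ * E α β n k)
        ≈ ⟦ ι j +ₑ α +ₑ β -ₑ 1ₑ choose j ⟧ * [ ι j +ₑ β ] ^ n
    worpitzky n j = trans
      -- The sum is the Cauchy product defining `F n j`; since k ≤ j, the truncated difference in
      -- `multichoose` agrees with the difference of exponents.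
      (sum-cong-≋ {suc j} λ i → let k = toℕ i in
        trans (*-comm _ (E α β n k)) (*-congˡ (choose-cong (j ∸ k) (
        Exp.trans
          (solveₑ 5 (λ j k n a b → j :-ₑ k :+ₑ n :+ₑ a :+ₑ b :-ₑ :1ₑ
                           :=ₑ (j :-ₑ k) :+ₑ (n :+ₑ a :+ₑ b) :-ₑ :1ₑ)
             Exp.refl (ι j) (ι k) (ι n) α β)
          (Exp.+-congʳ (Exp.+-congʳ (Exp.sym (ι-∸ (toℕ≤pred[n] i)))))))))
      (F-coeff n j)

    -- Inverts the Worpitzky identity: E_n is F_n times (x;q)_N with N = n+α+β, and the sum is the
    -- coefficient of x^k in that product.
    explicit : ∀ n k → E α β n k ≈
        ∑≤ k (λ j → ⟦ ι n +ₑ α +ₑ β choose k ∸ j ⟧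
                    * ⟦ ι j +ₑ α +ₑ β -ₑ 1ₑ choose j ⟧
                    * (- 1#) ^ (k ∸ j) * q ^ ((k ∸ j) C 2) * [ β +ₑ ι j ] ^ n)
    explicit n k = begin
      E α β n k
        ≈⟨ R.*-identityʳ (E α β n) k ⟨
      (E α β n *ˣ 1ˣ) k
        ≈⟨ R.*-congˡ {E α β n} (gauss-*-multichoose N) k ⟨
      (E α β n *ˣ (gauss N *ˣ multichoose N)) k
        ≈⟨ solveˢ 3 (λ e g m → e :*ˢ (g :*ˢ m) :=ˢ (e :*ˢ m) :*ˢ g)
             R.refl (E α β n) (gauss N) (multichoose N) k ⟩
      (F n *ˣ gauss N) k
        ≈⟨ sum-cong-≋ {suc k} (λ i → let j = toℕ i in begin
             F n j * gauss N (k ∸ j)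
               ≈⟨ *-congʳ (trans (F-coeff n j) (*-congˡ (^-congˡ n ([]-cong (Exp.+-comm (ι j) β))))) ⟩
             κ j * [ β +ₑ ι j ] ^ n * gauss N (k ∸ j)
               ≈⟨ solve 5 (λ c x g s Q → c :* x :* (g :* s :* Q) := g :* c :* s :* Q :* x)
                    refl _ _ _ _ _ ⟩
             ⟦ N choose k ∸ j ⟧ * κ j * (- 1#) ^ (k ∸ j) * q ^ ((k ∸ j) C 2) * [ β +ₑ ι j ] ^ n ∎) ⟩
      ∑≤ k (λ j → ⟦ N choose k ∸ j ⟧ * κ j * (- 1#) ^ (k ∸ j) * q ^ ((k ∸ j) C 2) * [ β +ₑ ι j ] ^ n) ∎
      where
      N : Exponent
      N = ι n +ₑ α +ₑ β

theorem1p2 : ∀ {c ℓ₁ ℓ₂ e ℓₑ ℓ₃} (𝕂 : QField c ℓ₁ ℓ₂ e ℓₑ ℓ₃) →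
    let open QEulerian 𝕂 in
    (α β : Exponent) →
    (∀ n →
    Eₓ α β (suc n) ≈ˣ
    (constˣ [ β ] +ˣ constˣ (q^⟨ β ⟩ * [ ι (suc n) -ₑ 1ₑ +ₑ α ]) *ˣ X) *ˣ Eₓ α β n
    +ˣ (1ˣ +ˣ -ˣ X) *ˣ X *ˣ constˣ q^⟨ β ⟩ *ˣ δ (Eₓ α β n))
    ×
    (∀ n →
    (λ j → X ^ˣ j *ˣ constˣ (⟦ ι j +ₑ α +ₑ β -ₑ 1ₑ choose j ⟧ * [ ι j +ₑ β ] ^ n))
    sumsToˣ (Eₓ α β n *ˣ recipˣ (qPochʳ (ι n +ₑ α +ₑ β))))
    ×
    (∃ λ S →
    ((λ n → constᵗ (Eₓ α β n *ˣ recipˣ (qPochʳ (ι n +ₑ α +ₑ β)))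
    *ˣᵗ (T ^ˣᵗ n *ˣᵗ constᵗ (constˣ (1/ n !))))
    sumsToˣᵗ S)
    ×
    ((λ j → constᵗ (X ^ˣ j *ˣ constˣ ⟦ ι j +ₑ α +ₑ β -ₑ 1ₑ choose j ⟧)
    *ˣᵗ exp⟨ [ ι j +ₑ β ] t⟩)
    sumsToˣᵗ S))
    ×
    (∀ n j →
    ∑≤ j (λ k → ⟦ ι j -ₑ ι k +ₑ ι n +ₑ α +ₑ β -ₑ 1ₑ choose j ∸ k ⟧ * E α β n k)
    ≈ ⟦ ι j +ₑ α +ₑ β -ₑ 1ₑ choose j ⟧ * [ ι j +ₑ β ] ^ n)
    ×
    (∀ n k → k ≤ n →
    E α β n k ≈
    ∑≤ k (λ j → ⟦ ι n +ₑ α +ₑ β choose k ∸ j ⟧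
    * ⟦ ι j +ₑ α +ₑ β -ₑ 1ₑ choose j ⟧
    * (- 1#) ^ (k ∸ j) * q ^ ((k ∸ j) C 2) * [ β +ₑ ι j ] ^ n))
theorem1p2 𝕂 α β =
    recursion α β
  , expansion α β
  , (generatingFunction α β , expansionˡ α β , expansionʳ α β)
  , worpitzky α β
  , λ n k _ → explicit α β n k
  where open QEulerianProperties 𝕂
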